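{- Let $n\ge m\ge 1$ be integers, and let $G=(V,E)$ be a finite multigraph with $n$ vertices. Assume that $G$ has no isolated vertices. Then $$c_{(m,1^{n-m})}(G)=\sum_{\omega\in Z(G)}\binom{s(\omega)-1}{n-m},$$ where $Z(G)$ is the set of acyclic orientations of $G$ with a unique sink and $s(\omega)$ is the number of sources of $\omega$.
   Context: Multigraphs may have loops and parallel edges. A vertex is isolated if it has no incident edges. The chromatic symmetric function of $G=(V,E)$ is $X(G):=\sum_{\chi}\prod_{v\in V}x_{\chi(v)}\in\mathbb{Z}[[x_1,x_2,\ldots]]$, where $\chi$ ranges over all proper vertex colorings $\chi:V\to\{1,2,\ldots\}$, i.e. the two endpoints of each edge receive different colors (so $X(G)=0$ if $G$ has a loop). It is a homogeneous symmetric function of degree $|V|$. With $e_m:=\sum_{1\le i_1<\cdots<i_m}x_{i_1}\cdots x_{i_m}$ and $e_\lambda:=e_{\lambda_1}\cdots e_{\lambda_r}$ for an integer partition $\lambda=(\lambda_1,\ldots,\lambda_r)$, the $e_\lambda$ with $\lambda$ of size $n$ form a basis of the homogeneous symmetric functions of degree $n$, and $c_\lambda(G)$ denotes the coefficient of $e_\lambda$ in the expansion $X(G)=\sum_\lambda c_\lambda(G)e_\lambda$. The notation $(m,1^{n-m})$ denotes the partition with one part of size $m$ and $n-m$ further parts of size $1$. An orientation of a multigraph chooses a direction for each edge; it is acyclic if it has no directed cycle (so a multigraph with a loop has no acyclic orientations, and parallel edges must be oriented in the same direction). A sink is a vertex of out-degree $0$; a source is a vertex of in-degree $0$. The binomial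 coefficient $\binom{a}{b}$, for integers $a\ge 0$ and $b$, is $0$ when $b<0$ or $b>a$. -}

module Defs where

open import Data.Bool.Base using (Bool; true; false; if_then_else_)
open import Data.Fin.Base using (Fin)
import Data.Fin.Properties as Fin
open import Data.Integer.Base as ℤ using (ℤ; +_; 0ℤ; 1ℤ)
open import Data.List.Base
  using (List; []; _∷_; map; filter; foldr; length; concatMap; upTo; allFin;
         cartesianProductWith)
open import Data.List.Membership.Propositional using (_∈_)
open import Data.List.Membership.Propositional.Properties using (∈-allFin)
open import Data.List.Relation.Unary.All using (All; all?)
open import Data.List.Relation.Unary.Any using (here; there)
open import Data.List.Relation.Unary.Linked using (Linked; linked?)
open import Data.Nat.Base using (ℕ; zero; suc; _≤_; _≥_; _∸_)
import Data.Nat.ListAction as ListAction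
open import Data.Nat.Properties using (_≟_; _≤?_; _≥?_)
open import Data.Product.Base using (_×_; _,_; proj₁; proj₂; ∃-syntax)
open import Data.Sum.Base using (_⊎_; inj₁; inj₂)
open import Data.Vec.Base as Vec using (Vec; []; _∷_; lookup)
import Data.Vec.Properties as Vec
import Data.Vec.Relation.Unary.All as VecAll
open import Level using (0ℓ)
open import Relation.Binary.Construct.Closure.Transitive
  using (TransClosure; [_]; _∷_; _++_)
open import Relation.Binary.Core using (Rel)
open import Relation.Binary.Definitions using (Decidable)
open import Relation.Binary.PropositionalEquality.Core using (_≡_; _≢_; refl)
open import Relation.Nullary.Decidable
  using (Dec; does; map′; ¬?; _×-dec_; _⊎-dec_)
open import Relation.Nullary.Negation.Core using (¬_)
import Relation.Unary as Unary

------------------------------------------------------------------------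
-- Finite enumerations and sums

words : ∀ {A : Set} → List A → ∀ n → List (Vec A n)
words as zero    = [] ∷ []
words as (suc n) = cartesianProductWith _∷_ as (words as n)

∑ : ∀ {A : Set} → List A → (A → ℤ) → ℤ
∑ xs f = foldr ℤ._+_ 0ℤ (map f xs)

------------------------------------------------------------------------
-- Formal power series in x₁, x₂, … over ℤ

-- A series is given by its coefficients: for α = (α₁, …, α_N), the value
-- f α is the coefficient of x₁^α₁ ⋯ x_N^α_N.  As N is arbitrary, every
-- monomial in the infinitely many variables occurs.

Series : Set
Series = ∀ {N} → Vec ℕ N → ℤ

infix 4 _≈_

_≈_ : Series → Series → Set
f ≈ g = ∀ {N} (α : Vec ℕ N) → f α ≡ g α

-- All pairs (β , γ) with β + γ = α.

splittings : ∀ {N} → Vec ℕ N → List (Vec ℕ N × Vec ℕ N)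
splittings []      = ([] , []) ∷ []
splittings (a ∷ α) =
  cartesianProductWith (λ { i (β , γ) → (i ∷ β) , ((a ∸ i) ∷ γ) })
    (upTo (suc a)) (splittings α)

infixl 7 _⊗_

_⊗_ : Series → Series → Series
(f ⊗ g) α = ∑ (splittings α) λ { (β , γ) → f β ℤ.* g γ }

𝟏 : Series
𝟏 α = if does (VecAll.all? (_≟ 0) α) then 1ℤ else 0ℤ

-- e m is the sum of the squarefree monomials of degree m.

e : ℕ → Series
e m α = if does (VecAll.all? (_≤? 1) α ×-dec (Vec.sum α ≟ m)) then 1ℤ else 0ℤ

eProduct : List ℕ → Series
eProduct []       = 𝟏
eProduct (k ∷ λs) = e k ⊗ eProduct λs

------------------------------------------------------------------------
-- Integer partitions

IsPartition : ℕ → List ℕ → Set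
IsPartition n λs = Linked _≥_ λs × All (1 ≤_) λs × ListAction.sum λs ≡ n

isPartition? : ∀ n → Unary.Decidable (IsPartition n)
isPartition? n λs =
  linked? _≥?_ λs ×-dec all? (1 ≤?_) λs ×-dec (ListAction.sum λs ≟ n)

-- A partition of n has at most n parts, each at most n.

partitions : ℕ → List (List ℕ)
partitions n = filter (isPartition? n)
  (concatMap (λ k → map Vec.toList (words (upTo (suc n)) k)) (upTo (suc n)))

-- f = Σ_{λ ⊢ n} c_λ e_λ; values of c off the partitions of n are irrelevant.

IsEExpansion : ℕ → Series → (List ℕ → ℤ) → Set
IsEExpansion n f c =
  f ≈ λ α → ∑ (partitions n) λ λs → c λs ℤ.* eProduct λs α

------------------------------------------------------------------------
-- Multigraphs

-- Loops and parallel edges are allowed.  Edges are undirected: the order in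
-- which ends lists the two endpoints is only a reference for orientations.

record Multigraph (n : ℕ) : Set where
  field
    #edges : ℕ
    ends   : Fin #edges → Fin n × Fin n

-- Transitive closure on Fin n is decidable: Via is x y means that y can be
-- reached from x by a nonempty walk with intermediate points in is.

module Reachability {n : ℕ} {R : Rel (Fin n) 0ℓ} (R? : Decidable R) where

  Via : List (Fin n) → Rel (Fin n) 0ℓ
  Via []       x y = R x y
  Via (i ∷ is) x y = Via is x y ⊎ (Via is x i × Via is i y)

  via? : ∀ is → Decidable (Via is)
  via? []       x y = R? x y
  via? (i ∷ is) x y = via? is x y ⊎-dec (via? is x i ×-dec via? is i y)

  via⇒⁺ : ∀ is {x y} → Via is x y → TransClosure R x y
  via⇒⁺ []       r              = [ r ]
  via⇒⁺ (i ∷ is) (inj₁ p)       = via⇒⁺ is p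
  via⇒⁺ (i ∷ is) (inj₂ (p , q)) = via⇒⁺ is p ++ via⇒⁺ is q

  R⇒via : ∀ is {x y} → R x y → Via is x y
  R⇒via []       r = r
  R⇒via (i ∷ is) r = inj₁ (R⇒via is r)

  to-head : ∀ i is {x} → Via (i ∷ is) x i → Via is x i
  to-head i is (inj₁ p)       = p
  to-head i is (inj₂ (p , _)) = p

  from-head : ∀ i is {y} → Via (i ∷ is) i y → Via is i y
  from-head i is (inj₁ q)       = q
  from-head i is (inj₂ (_ , q)) = q

  through : ∀ is {x j y} → j ∈ is → Via is x j → Via is j y → Via is x y
  through (i ∷ is) (here refl) p q = inj₂ (to-head i is p , from-head i is q)
  through (i ∷ is) (there j∈) (inj₁ p)       (inj₁ q)       = inj₁ (through is j∈ p q)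
  through (i ∷ is) (there j∈) (inj₁ p)       (inj₂ (q , r)) = inj₂ (through is j∈ p q , r)
  through (i ∷ is) (there j∈) (inj₂ (p , q)) (inj₁ r)       = inj₂ (p , through is j∈ q r)
  through (i ∷ is) (there j∈) (inj₂ (p , _)) (inj₂ (_ , s)) = inj₂ (p , s)

  ⁺⇒via : ∀ {x y} → TransClosure R x y → Via (allFin n) x y
  ⁺⇒via [ r ]    = R⇒via (allFin n) r
  ⁺⇒via (r ∷ rs) = through (allFin n) (∈-allFin _) (R⇒via (allFin n) r) (⁺⇒via rs)

  ⁺? : Decidable (TransClosure R)
  ⁺? x y = map′ (via⇒⁺ (allFin n)) ⁺⇒via (via? (allFin n) x y)

module _ {n : ℕ} (G : Multigraph n) where

  open Multigraph G

  Incident : Fin n → Fin #edges → Set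
  Incident v ε = (proj₁ (ends ε) ≡ v) ⊎ (proj₂ (ends ε) ≡ v)

  Isolated : Fin n → Set
  Isolated v = ∀ ε → ¬ Incident v ε

  Proper : ∀ {N} → Vec (Fin N) n → Set
  Proper χ = ∀ ε → lookup χ (proj₁ (ends ε)) ≢ lookup χ (proj₂ (ends ε))

  proper? : ∀ {N} → Unary.Decidable (Proper {N})
  proper? χ =
    Fin.all? λ ε → ¬? (lookup χ (proj₁ (ends ε)) Fin.≟ lookup χ (proj₂ (ends ε)))

  -- The exponent vector of ∏_v x_{χ(v)}.

  content : ∀ {N} → Vec (Fin N) n → Vec ℕ N
  content χ = Vec.tabulate λ i → Vec.count (Fin._≟ i) χ

  -- A coloring contributing to the monomial with exponents (α₁, …, α_N) only
  -- uses the colors 1, …, N, represented here by Fin N.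

  X : Series
  X {N} α = + length (filter
    (λ χ → proper? χ ×-dec Vec.≡-dec _≟_ (content χ) α)
    (words (allFin N) n))

  -- true directs the edge ε from the first to the second component of ends ε,
  -- false the other way.  A loop has two such orientations, but neither is
  -- acyclic.

  Orientation : Set
  Orientation = Vec Bool #edges

  orientations : List Orientation
  orientations = words (true ∷ false ∷ []) #edges

  module _ (ω : Orientation) where

    tail head : Fin #edges → Fin n
    tail ε = if lookup ω ε then proj₁ (ends ε) else proj₂ (ends ε)
    head ε = if lookup ω ε then proj₂ (ends ε) else proj₁ (ends ε)

    Arc : Rel (Fin n) 0ℓ
    Arc u v = ∃[ ε ] (tail ε ≡ u × head ε ≡ v)

    arc? : Decidable Arc
    arc? u v = Fin.any? λ ε → (tail ε Fin.≟ u) ×-dec (head ε Fin.≟ v)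

    -- No closed directed walk of positive length.

    Acyclic : Set
    Acyclic = ∀ v → ¬ TransClosure Arc v v

    acyclic? : Dec Acyclic
    acyclic? = Fin.all? λ v → ¬? (Reachability.⁺? arc? v v)

    outDegree inDegree : Fin n → ℕ
    outDegree v = length (filter (λ ε → tail ε Fin.≟ v) (allFin #edges))
    inDegree  v = length (filter (λ ε → head ε Fin.≟ v) (allFin #edges))

    #sinks #sources : ℕ
    #sinks   = length (filter (λ v → outDegree v ≟ 0) (allFin n))
    #sources = length (filter (λ v → inDegree  v ≟ 0) (allFin n))

  Z : List Orientation
  Z = filter (λ ω → acyclic? ω ×-dec (#sinks ω ≟ 1)) orientations

{-# OPTIONS --safe #-}

-- For a symmetric function f of degree n and r = n - m, put
--
--   L(f) = Σ_{k ≤ r} Σ_β (-1)^(r-k) (-1)^(|β|-ℓ(β)) β₁ [x^(k,β)] f,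
--
-- where β runs over the compositions of n - k.  Reading the monomials of e_λ one
-- variable at a time shows L(e_λ) = 0 unless λ is the hook (m,1^r), and L = 1 there (L = n
-- if m = 1).  So L(X(G)) is the coefficient sought; for m = 1 both sides vanish.
--
-- A proper coloring orients every edge from the larger to the smaller color, the first
-- color being regarded as the largest.  For a fixed orientation ω the signed sum then peels
-- off a set S of k sources followed by nonempty sets of sinks of what remains.
-- It is 0 if ω has a cycle.  Otherwise Σ_{∅≠T⊆U} (-1)^(|T|-1) = 1 for U ≠ ∅ collapses
-- the sum over β to [ω - S has a unique sink], because
-- Σ_{T⊆U} (-1)^(|T|-1) |T| = [|U| = 1].  As no vertex is isolated, ω - S has the
-- same sinks as ω, and Σ_{S} (-1)^(r-|S|) over the sets of at most r sources
-- is C(s(ω) - 1, r).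
module Submission where

open import Defs
import Algebra.Properties.CommutativeSemigroup as CommutativeSemigroup
open import Data.Bool.Base using (Bool; true; false; if_then_else_)
open import Data.Bool.Properties using (∧-zeroʳ)
open import Data.Empty using (⊥)
open import Data.Fin.Base as Fin using (Fin; zero; suc)
open import Data.Fin.Induction using (spo-wellFounded; spo-noetherian)
import Data.Fin.Properties as Fin
open import Data.Fin.Subset as Subset using (Subset; ⊤; _∩_; _─_; _⊆_; ∣_∣)
import Data.Fin.Subset.Properties as Subset
open import Data.Integer.Base using (ℤ; +_; 0ℤ; 1ℤ; _+_; _*_; -_)
import Data.Integer.Properties as ℤ
open import Data.Integer.Tactic.RingSolver using (solve-∀)
open import Data.List.Base
  using (List; []; _∷_; _++_; map; filter; length; concatMap; upTo; allFin;
         cartesianProductWith; replicate; tabulate)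
open import Data.List.Membership.Propositional using (_∈_; lose)
open import Data.List.Membership.Propositional.Properties
  using (∈-map⁻; ∈-++⁻; ∈-filter⁻; ∈-cartesianProductWith⁻; ∈-allFin)
open import Data.List.Properties
  using (∷-injectiveˡ; ∷-injectiveʳ; length-replicate; ≡-dec; filter-some; filter-none;
         map-applyUpTo; map-tabulate)
open import Data.List.Relation.Unary.All as All using (All; []; _∷_)
import Data.List.Relation.Unary.All.Properties as All
open import Data.List.Relation.Unary.Any using (here; there)
open import Data.List.Relation.Unary.Linked using (Linked; []; [-]; _∷_)
open import Data.Maybe.Base using (Maybe; just; nothing)
import Data.Maybe.Properties as Maybe
open import Data.Nat.Base as ℕ using (ℕ; zero; suc; _∸_; _≤_; _<_; _≥_; z≤n; s≤s)
open import Data.Nat.Combinatorics using (_C_; nCk+nC[k+1]≡[n+1]C[k+1]; k>n⇒nCk≡0)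
import Data.Nat.ListAction as ℕ
import Data.Nat.Properties as ℕ
open import Data.Nat.Properties using (_≟_; _≤?_)
open import Data.Product.Base using (_×_; _,_; proj₁; proj₂; map₂; ∃-syntax)
open import Data.Sum.Base using (inj₁; inj₂)
open import Data.Unit.Base using (tt) renaming (⊤ to Unit)
open import Data.Vec.Base as Vec using (Vec; []; _∷_; lookup)
import Data.Vec.Properties as Vec
import Data.Vec.Relation.Unary.All as VecAll
open import Function.Base using (_∘_; id)
open import Function.Bundles using (mk⇔)
open import Induction.WellFounded using (Acc; acc)
open import Relation.Binary.Construct.Closure.Transitive using (TransClosure; [_]; _∷_)
  renaming (_++_ to _++⁺_)
open import Relation.Binary.Definitions using (DecidableEquality; tri<; tri≈; tri>)
open import Relation.Binary.PropositionalEquality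
open import Relation.Binary.Structures using (IsStrictPartialOrder)
open import Relation.Nullary.Decidable
  using (Dec; does; yes; no; _×-dec_; _→-dec_; ¬?; does-⇔; dec-true; dec-false)
open import Relation.Nullary.Negation using (¬_; contradiction)
import Relation.Unary as Unary

open ≡-Reasoning

private
  module ℕ+ = CommutativeSemigroup ℕ.+-commutativeSemigroup
  module ℤ+ = CommutativeSemigroup ℤ.+-commutativeSemigroup
  module ℤ* = CommutativeSemigroup ℤ.*-commutativeSemigroup

  variable
    A B I P Q : Set
    n N : ℕ

-- Indicators of decidable propositions and finite integer sums.

⟦_⟧ : Dec P → ℤ
⟦ d ⟧ = if does d then 1ℤ else 0ℤ

⟦⟧-cong : (p : Dec P) (q : Dec Q) → (P → Q) → (Q → P) → ⟦ p ⟧ ≡ ⟦ q ⟧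
⟦⟧-cong p q to from = cong (if_then 1ℤ else 0ℤ) (does-⇔ (mk⇔ to from) p q)

⟦⟧-true : (p : Dec P) → P → ⟦ p ⟧ ≡ 1ℤ
⟦⟧-true p x = cong (if_then 1ℤ else 0ℤ) (dec-true p x)

⟦⟧-false : (p : Dec P) → ¬ P → ⟦ p ⟧ ≡ 0ℤ
⟦⟧-false p x = cong (if_then 1ℤ else 0ℤ) (dec-false p x)

⟦⟧-× : (p : Dec P) (q : Dec Q) → ⟦ p ×-dec q ⟧ ≡ ⟦ p ⟧ * ⟦ q ⟧
⟦⟧-× p q with does p
... | true  = sym (ℤ.*-identityˡ ⟦ q ⟧)
... | false = refl

⟦⟧*-cong : (p : Dec P) {x y : ℤ} → (P → x ≡ y) → ⟦ p ⟧ * x ≡ ⟦ p ⟧ * y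
⟦⟧*-cong (yes p) x≡y = cong (1ℤ *_) (x≡y p)
⟦⟧*-cong (no _)  _   = refl

∑-cong-∈ : ∀ (xs : List A) {f g : A → ℤ} → (∀ {x} → x ∈ xs → f x ≡ g x) → ∑ xs f ≡ ∑ xs g
∑-cong-∈ []       f≡g = refl
∑-cong-∈ (x ∷ xs) f≡g = cong₂ _+_ (f≡g (here refl)) (∑-cong-∈ xs (f≡g ∘ there))

∑-cong : ∀ (xs : List A) {f g : A → ℤ} → (∀ x → f x ≡ g x) → ∑ xs f ≡ ∑ xs g
∑-cong xs f≡g = ∑-cong-∈ xs (λ {x} _ → f≡g x)

∑-++ : ∀ (xs ys : List A) (f : A → ℤ) → ∑ (xs ++ ys) f ≡ ∑ xs f + ∑ ys f
∑-++ []       ys f = sym (ℤ.+-identityˡ _)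
∑-++ (x ∷ xs) ys f = trans (cong (_+_ (f x)) (∑-++ xs ys f)) (sym (ℤ.+-assoc (f x) _ _))

∑-map : ∀ (h : A → B) xs (f : B → ℤ) → ∑ (map h xs) f ≡ ∑ xs (f ∘ h)
∑-map h []       f = refl
∑-map h (x ∷ xs) f = cong (_+_ (f (h x))) (∑-map h xs f)

∑-zero : ∀ (xs : List A) {f : A → ℤ} → (∀ {x} → x ∈ xs → f x ≡ 0ℤ) → ∑ xs f ≡ 0ℤ
∑-zero []       f≡0 = refl
∑-zero (x ∷ xs) f≡0 = cong₂ _+_ (f≡0 (here refl)) (∑-zero xs (f≡0 ∘ there))

∑-+ : ∀ (xs : List A) (f g : A → ℤ) → ∑ xs (λ x → f x + g x) ≡ ∑ xs f + ∑ xs g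
∑-+ []       f g = refl
∑-+ (x ∷ xs) f g = trans (cong (_+_ (f x + g x)) (∑-+ xs f g)) (ℤ+.interchange (f x) (g x) _ _)

∑-*ˡ : ∀ (xs : List A) c (f : A → ℤ) → ∑ xs (λ x → c * f x) ≡ c * ∑ xs f
∑-*ˡ []       c f = sym (ℤ.*-zeroʳ c)
∑-*ˡ (x ∷ xs) c f = trans (cong (_+_ (c * f x)) (∑-*ˡ xs c f)) (sym (ℤ.*-distribˡ-+ c (f x) _))

∑-*ʳ : ∀ (xs : List A) c (f : A → ℤ) → ∑ xs (λ x → f x * c) ≡ ∑ xs f * c
∑-*ʳ xs c f = trans (∑-cong xs (λ x → ℤ.*-comm (f x) c)) (trans (∑-*ˡ xs c f) (ℤ.*-comm c _))

∑-swap : ∀ (xs : List A) (ys : List B) (f : A → B → ℤ) →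
  ∑ xs (λ x → ∑ ys (f x)) ≡ ∑ ys (λ y → ∑ xs (λ x → f x y))
∑-swap []       ys f = sym (∑-zero ys (λ _ → refl))
∑-swap (x ∷ xs) ys f =
  trans (cong (_+_ (∑ ys (f x))) (∑-swap xs ys f)) (sym (∑-+ ys (f x) _))

∑-cartesianProductWith : ∀ (h : A → B → I) xs ys (f : I → ℤ) →
  ∑ (cartesianProductWith h xs ys) f ≡ ∑ xs (λ x → ∑ ys (λ y → f (h x y)))
∑-cartesianProductWith h []       ys f = refl
∑-cartesianProductWith h (x ∷ xs) ys f = trans
  (∑-++ (map (h x) ys) _ f)
  (cong₂ _+_ (∑-map (h x) ys f) (∑-cartesianProductWith h xs ys f))

∑-concatMap : ∀ (h : A → List B) xs (f : B → ℤ) →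
  ∑ (concatMap h xs) f ≡ ∑ xs (λ x → ∑ (h x) f)
∑-concatMap h []       f = refl
∑-concatMap h (x ∷ xs) f =
  trans (∑-++ (h x) _ f) (cong (_+_ (∑ (h x) f)) (∑-concatMap h xs f))

∑-filter : {R : A → Set} (R? : Unary.Decidable R) (xs : List A) (f : A → ℤ) →
  ∑ (filter R? xs) f ≡ ∑ xs (λ x → ⟦ R? x ⟧ * f x)
∑-filter R? []       f = refl
∑-filter R? (x ∷ xs) f with does (R? x)
... | true  = cong₂ _+_ (sym (ℤ.*-identityˡ (f x))) (∑-filter R? xs f)
... | false = trans (∑-filter R? xs f) (sym (ℤ.+-identityˡ _))

∑-length-filter : {R : A → Set} (R? : Unary.Decidable R) (xs : List A) →
  + length (filter R? xs) ≡ ∑ xs (λ x → ⟦ R? x ⟧)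
∑-length-filter R? []       = refl
∑-length-filter R? (x ∷ xs) with does (R? x)
... | true  = cong (_+_ (1ℤ)) (∑-length-filter R? xs)
... | false = trans (∑-length-filter R? xs) (sym (ℤ.+-identityˡ _))

∑-upTo-suc : ∀ n (f : ℕ → ℤ) → ∑ (upTo (suc n)) f ≡ f 0 + ∑ (upTo n) (f ∘ suc)
∑-upTo-suc n f = cong (_+_ (f 0))
  (trans (cong (λ xs → ∑ xs f) (sym (map-applyUpTo id suc n))) (∑-map suc (upTo n) f))

∑-allFin-suc : ∀ n (f : Fin (suc n) → ℤ) → ∑ (allFin (suc n)) f ≡ f zero + ∑ (allFin n) (f ∘ suc)
∑-allFin-suc n f = cong (_+_ (f zero))
  (trans (cong (λ xs → ∑ xs f) (sym (map-tabulate id suc))) (∑-map suc (allFin n) f))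

∑-upTo-δ : ∀ {j n} → j < n → (f : ℕ → ℤ) → ∑ (upTo n) (λ a → ⟦ j ≟ a ⟧ * f a) ≡ f j
∑-upTo-δ {zero}  {suc n} _         f = begin
  ∑ (upTo (suc n)) (λ a → ⟦ 0 ≟ a ⟧ * f a)  ≡⟨ ∑-upTo-suc n (λ a → ⟦ 0 ≟ a ⟧ * f a) ⟩
  1ℤ * f 0 + ∑ (upTo n) (λ _ → 0ℤ)         ≡⟨ cong₂ _+_ (ℤ.*-identityˡ (f 0)) (∑-zero (upTo n) (λ _ → refl)) ⟩
  f 0 + 0ℤ                                 ≡⟨ ℤ.+-identityʳ (f 0) ⟩
  f 0                                      ∎
∑-upTo-δ {suc j} {suc n} (s≤s j<n) f = begin
  ∑ (upTo (suc n)) (λ a → ⟦ suc j ≟ a ⟧ * f a)       ≡⟨ ∑-upTo-suc n (λ a → ⟦ suc j ≟ a ⟧ * f a) ⟩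
  0ℤ + ∑ (upTo n) (λ a → ⟦ j ≟ a ⟧ * f (suc a))      ≡⟨ ℤ.+-identityˡ _ ⟩
  ∑ (upTo n) (λ a → ⟦ j ≟ a ⟧ * f (suc a))           ≡⟨ ∑-upTo-δ j<n (f ∘ suc) ⟩
  f (suc j)                                          ∎

-- Alternating binomial sums

-- This is the sum of C(d,j) g(j) over j. Building in Pascal's rule matches the recursions for
-- `subsets` and `strips`, where one more element is either left out or taken.
∑-choose : ℕ → (ℕ → ℤ) → ℤ
∑-choose zero    g = g 0
∑-choose (suc d) g = ∑-choose d g + ∑-choose d (g ∘ suc)

∑-choose-cong : ∀ d {f g : ℕ → ℤ} → (∀ a → f a ≡ g a) → ∑-choose d f ≡ ∑-choose d g
∑-choose-cong zero    f≡g = f≡g 0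
∑-choose-cong (suc d) f≡g = cong₂ _+_ (∑-choose-cong d f≡g) (∑-choose-cong d (f≡g ∘ suc))

∑-choose-+ : ∀ d (f g : ℕ → ℤ) →
  ∑-choose d f + ∑-choose d g ≡ ∑-choose d (λ a → f a + g a)
∑-choose-+ zero    f g = refl
∑-choose-+ (suc d) f g = trans
  (ℤ+.interchange (∑-choose d f) _ (∑-choose d g) _)
  (cong₂ _+_ (∑-choose-+ d f g) (∑-choose-+ d (f ∘ suc) (g ∘ suc)))

∑-choose-zero : ∀ d → ∑-choose d (λ _ → 0ℤ) ≡ 0ℤ
∑-choose-zero zero    = refl
∑-choose-zero (suc d) = cong₂ _+_ (∑-choose-zero d) (∑-choose-zero d)

±1 : ℕ → ℤ
±1 zero    = 1ℤ
±1 (suc a) = - ±1 a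

∑-choose-±1 : ∀ d → ∑-choose d ±1 ≡ ⟦ d ≟ 0 ⟧
∑-choose-±1 zero    = refl
∑-choose-±1 (suc d) = begin
  ∑-choose d ±1 + ∑-choose d (±1 ∘ suc)    ≡⟨ ∑-choose-+ d ±1 (±1 ∘ suc) ⟩
  ∑-choose d (λ a → ±1 a + - ±1 a)          ≡⟨ ∑-choose-cong d (λ a → ℤ.+-inverseʳ (±1 a)) ⟩
  ∑-choose d (λ _ → 0ℤ)                     ≡⟨ ∑-choose-zero d ⟩
  0ℤ                                        ∎

-- The value 0 at 0 makes sums weighted by μ range over nonempty sets.
μ : ℕ → ℤ
μ zero    = 0ℤ
μ (suc a) = ±1 a

-- Inclusion-exclusion over the nonempty subsets of a d-set. The indicator supplies the missing case
-- d = 0; inside `T` it comes from the constant term `f []`.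
∑-choose-μ : ∀ d → ⟦ d ≟ 0 ⟧ + ∑-choose d μ ≡ 1ℤ
∑-choose-μ zero          = refl
∑-choose-μ (suc zero)    = refl
∑-choose-μ (suc (suc d)) = begin
  0ℤ + (∑-choose (suc d) μ + ∑-choose (suc d) ±1)        ≡⟨ ℤ.+-identityˡ _ ⟩
  ∑-choose (suc d) μ + ∑-choose (suc d) ±1    ≡⟨ cong₂ _+_ (trans (sym (ℤ.+-identityˡ (∑-choose (suc d) μ))) (∑-choose-μ (suc d))) (∑-choose-±1 (suc d)) ⟩
  1ℤ                                            ∎

aμ : ℕ → ℤ
aμ a = + a * μ a

-- Pascal's rule pairs a with a + 1, and `aμ a + aμ (suc a)` is `±1 a`, so the sum drops to an
-- alternating sum over a set with one element fewer.
∑-choose-aμ : ∀ d → ∑-choose d aμ ≡ ⟦ d ≟ 1 ⟧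
∑-choose-aμ zero    = refl
∑-choose-aμ (suc d) = begin
  ∑-choose d aμ + ∑-choose d (aμ ∘ suc)    ≡⟨ ∑-choose-+ d aμ (aμ ∘ suc) ⟩
  ∑-choose d (λ a → aμ a + aμ (suc a))      ≡⟨ ∑-choose-cong d telescope ⟩
  ∑-choose d ±1                             ≡⟨ ∑-choose-±1 d ⟩
  ⟦ suc d ≟ 1 ⟧                             ∎
  where
  telescope′ : ∀ x y → (1ℤ + x) * y + (1ℤ + (1ℤ + x)) * - y ≡ - y
  telescope′ = solve-∀
  telescope : ∀ a → aμ a + aμ (suc a) ≡ ±1 a
  telescope zero    = refl
  telescope (suc a) = telescope′ (+ a) (±1 a)

∑-choose-δ : ∀ d r → ∑-choose d (λ a → ⟦ a ≟ r ⟧) ≡ + (d C r)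
∑-choose-δ zero    zero    = refl
∑-choose-δ zero    (suc r) = refl
∑-choose-δ (suc d) zero    =
  trans (cong₂ _+_ (∑-choose-δ d 0) (∑-choose-zero d)) refl
∑-choose-δ (suc d) (suc r) = begin
  ∑-choose d (λ a → ⟦ a ≟ suc r ⟧) + ∑-choose d (λ a → ⟦ a ≟ r ⟧)
    ≡⟨ cong₂ _+_ (∑-choose-δ d (suc r)) (∑-choose-δ d r) ⟩
  + (d C suc r) + + (d C r)            ≡⟨ ℤ.+-comm (+ (d C suc r)) (+ (d C r)) ⟩
  + (d C r ℕ.+ d C suc r)              ≡⟨ cong +_ (nCk+nC[k+1]≡[n+1]C[k+1] d r) ⟩
  + (suc d C suc r)                    ∎

-- σ r k = (-1)^(r-k) for k ≤ r, and 0 otherwise.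
σ : ℕ → ℕ → ℤ
σ r       zero    = ±1 r
σ zero    (suc k) = 0ℤ
σ (suc r) (suc k) = σ r k

σ-telescope : ∀ r k → σ r k + σ r (suc k) ≡ ⟦ k ≟ r ⟧
σ-telescope zero    zero    = refl
σ-telescope zero    (suc k) = refl
σ-telescope (suc r) zero    = ℤ.+-inverseˡ (±1 r)
σ-telescope (suc r) (suc k) = σ-telescope r k

-- A truncated alternating row sum of Pascal's triangle: pairing k with k + 1 leaves only k = r.
∑-choose-σ : ∀ r d → ∑-choose (suc d) (σ r) ≡ + (d C r)
∑-choose-σ r d = begin
  ∑-choose d (σ r) + ∑-choose d (σ r ∘ suc)     ≡⟨ ∑-choose-+ d (σ r) (σ r ∘ suc) ⟩
  ∑-choose d (λ k → σ r k + σ r (suc k))         ≡⟨ ∑-choose-cong d (σ-telescope r) ⟩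
  ∑-choose d (λ k → ⟦ k ≟ r ⟧)                   ≡⟨ ∑-choose-δ d r ⟩
  + (d C r)                                      ∎

-- Signed sums over the exponents, one variable at a time.

module _ (n : ℕ) where

  -- D g substitutes g a for x₁^a, and T M f is the sum of (-1)^(|α|-N) f α over all N < M
  -- and α ∈ {1, …, n}^N.
  D : (ℕ → ℤ) → Series → Series
  D g f α = ∑ (upTo (suc n)) λ a → g a * f (a ∷ α)

  D-cong : ∀ g {f h : Series} → f ≈ h → D g f ≈ D g h
  D-cong g f≈h α = ∑-cong (upTo (suc n)) (λ a → cong (g a *_) (f≈h (a ∷ α)))

  D-∑ : ∀ g (xs : List A) (c : A → ℤ) (F : A → Series) →
    D g (λ α → ∑ xs λ x → c x * F x α) ≈ λ α → ∑ xs λ x → c x * D g (F x) α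
  D-∑ g xs c F α = begin
    ∑ (upTo (suc n)) (λ a → g a * ∑ xs (λ x → c x * F x (a ∷ α)))
      ≡⟨ ∑-cong (upTo (suc n)) (λ a → trans (sym (∑-*ˡ xs (g a) _))
           (∑-cong xs (λ x → ℤ*.x∙yz≈y∙xz (g a) (c x) _))) ⟩
    ∑ (upTo (suc n)) (λ a → ∑ xs (λ x → c x * (g a * F x (a ∷ α))))
      ≡⟨ ∑-swap (upTo (suc n)) xs _ ⟩
    ∑ xs (λ x → ∑ (upTo (suc n)) (λ a → c x * (g a * F x (a ∷ α))))
      ≡⟨ ∑-cong xs (λ x → ∑-*ˡ (upTo (suc n)) (c x) _) ⟩
    ∑ xs (λ x → c x * D g (F x) α) ∎

  -- Each `x` in `xs` stands for a term of degree `deg x` in the first variable. The bound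
  -- `deg x ≤ n` keeps that degree inside the range of `D`, which therefore meets the term exactly
  -- once.
  D-graded : ∀ g {f : Series} {N} (α : Vec ℕ N) (xs : List A) (deg : A → ℕ) (c : A → ℤ) →
    (∀ {x} → x ∈ xs → deg x ≤ n) →
    (∀ a → f (a ∷ α) ≡ ∑ xs (λ x → ⟦ deg x ≟ a ⟧ * c x)) →
    D g f α ≡ ∑ xs λ x → g (deg x) * c x
  D-graded g {f} α xs deg c deg≤n f≡ = begin
    ∑ (upTo (suc n)) (λ a → g a * f (a ∷ α))
      ≡⟨ ∑-cong (upTo (suc n)) (λ a → trans (cong (g a *_) (f≡ a)) (trans (sym (∑-*ˡ xs (g a) _))
           (∑-cong xs (λ x → ℤ*.x∙yz≈y∙xz (g a) ⟦ deg x ≟ a ⟧ (c x))))) ⟩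
    ∑ (upTo (suc n)) (λ a → ∑ xs (λ x → ⟦ deg x ≟ a ⟧ * (g a * c x)))
      ≡⟨ ∑-swap (upTo (suc n)) xs _ ⟩
    ∑ xs (λ x → ∑ (upTo (suc n)) (λ a → ⟦ deg x ≟ a ⟧ * (g a * c x)))
      ≡⟨ ∑-cong-∈ xs (λ {x} x∈ → ∑-upTo-δ (s≤s (deg≤n x∈)) (λ a → g a * c x)) ⟩
    ∑ xs (λ x → g (deg x) * c x) ∎

  T : ℕ → Series → ℤ
  T zero    f = 0ℤ
  T (suc M) f = f [] + T M (D μ f)

  T-cong : ∀ M {f h : Series} → f ≈ h → T M f ≡ T M h
  T-cong zero    f≈h = refl
  T-cong (suc M) {f} {h} f≈h = cong₂ _+_ (f≈h []) (T-cong M {D μ f} {D μ h} (D-cong μ {f} {h} f≈h))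

  T-∑ : ∀ M (xs : List A) (c : A → ℤ) (F : A → Series) →
    T M (λ α → ∑ xs λ x → c x * F x α) ≡ ∑ xs λ x → c x * T M (F x)
  T-∑ zero    xs c F = sym (∑-zero xs (λ {x} _ → ℤ.*-zeroʳ (c x)))
  T-∑ (suc M) xs c F = begin
    ∑ xs (λ x → c x * F x []) + T M (D μ (λ α → ∑ xs λ x → c x * F x α))
      ≡⟨ cong (_+_ (∑ xs (λ x → c x * F x []))) (trans
           (T-cong M {D μ (λ α → ∑ xs λ x → c x * F x α)} {λ α → ∑ xs λ x → c x * D μ (F x) α} (D-∑ μ xs c F))
           (T-∑ M xs c (λ x → D μ (F x)))) ⟩
    ∑ xs (λ x → c x * F x []) + ∑ xs (λ x → c x * T M (D μ (F x)))
      ≡⟨ ∑-+ xs _ _ ⟨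
    ∑ xs (λ x → c x * F x [] + c x * T M (D μ (F x)))
      ≡⟨ ∑-cong xs (λ x → sym (ℤ.*-distribˡ-+ (c x) (F x []) _)) ⟩
    ∑ xs (λ x → c x * T (suc M) (F x)) ∎

  -- The common pattern of e-products and of colorings increasing along an acyclic orientation.
  -- Reading one variable of `F s` takes away a subset of `width s` available elements and leaves a
  -- state smaller by the number taken; the constant term is 1 exactly when nothing is available.
  module _ (F : A → Series) (strip : A → List (ℕ × A)) (width size : A → ℕ)
    (F-[] : ∀ s → F s [] ≡ ⟦ width s ≟ 0 ⟧)
    (F-∷ : ∀ s {N} a (α : Vec ℕ N) →
           F s (a ∷ α) ≡ ∑ (strip s) λ p → ⟦ proj₁ p ≟ a ⟧ * F (proj₂ p) α)
    (∑-strip : ∀ s g → ∑ (strip s) (g ∘ proj₁) ≡ ∑-choose (width s) g)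
    (strip-size : ∀ s {p} → p ∈ strip s → proj₁ p ℕ.+ size (proj₂ p) ≡ size s)
    where

    -- Induction on `M`, mutual with `T-D-strip`. Once every smaller state has value 1, the first
    -- variable leaves a μ-weighted sum over subsets, which `∑-choose-μ` evaluates together with the
    -- constant term.
    T-strip : ∀ M s → size s < M → size s ≤ n → T M (F s) ≡ 1ℤ
    T-D-strip : ∀ M g s → g 0 ≡ 0ℤ → size s ≤ M → size s ≤ n →
      T M (D g (F s)) ≡ ∑-choose (width s) g

    T-strip (suc M) s (s≤s s≤M) s≤n =
      trans (cong₂ _+_ (F-[] s) (T-D-strip M μ s refl s≤M s≤n)) (∑-choose-μ (width s))

    T-D-strip M g s g0≡0 s≤M s≤n = begin
      T M (D g (F s))
        ≡⟨ T-cong M {D g (F s)} {λ α → ∑ (strip s) λ p → g (proj₁ p) * F (proj₂ p) α} (λ α →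
             D-graded g {F s} α (strip s) proj₁ (λ p → F (proj₂ p) α)
               (λ p∈ → ℕ.≤-trans (ℕ.m≤m+n _ _) (ℕ.≤-trans (ℕ.≤-reflexive (strip-size s p∈)) s≤n))
               (λ a → F-∷ s a α)) ⟩
      T M (λ α → ∑ (strip s) λ p → g (proj₁ p) * F (proj₂ p) α)
        ≡⟨ T-∑ M (strip s) (g ∘ proj₁) (F ∘ proj₂) ⟩
      ∑ (strip s) (λ p → g (proj₁ p) * T M (F (proj₂ p)))
        ≡⟨ ∑-cong-∈ (strip s) (λ {p} p∈ → rest (proj₁ p) (proj₂ p) (strip-size s p∈)) ⟩
      ∑ (strip s) (g ∘ proj₁)
        ≡⟨ ∑-strip s g ⟩
      ∑-choose (width s) g ∎
      where
      rest : ∀ j s′ → j ℕ.+ size s′ ≡ size s → g j * T M (F s′) ≡ g j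
      -- Nothing is taken, so the size does not drop and the induction hypothesis is out of reach;
      -- the weight `g 0` removes the term.
      rest zero    s′ eq rewrite g0≡0 = refl
      rest (suc j) s′ eq =
        trans (cong (g (suc j) *_) (T-strip M s′ (ℕ.<-≤-trans s′<s s≤M) (ℕ.≤-trans (ℕ.<⇒≤ s′<s) s≤n)))
              (ℤ.*-identityʳ _)
        where
        s′<s : size s′ < size s
        s′<s = ℕ.≤-trans (s≤s (ℕ.m≤n+m (size s′) j)) (ℕ.≤-reflexive eq)

-- Products of elementary symmetric functions, one variable at a time.

-- Strips of P encode the squarefree choices of factors x₁ in e_P: lower some nonzero
-- parts by one, and record how many.  Zero parts are kept.
strips : List ℕ → List (ℕ × List ℕ)
strips []          = (0 , []) ∷ []
strips (zero  ∷ P) = map (map₂ (0 ∷_)) (strips P)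
strips (suc k ∷ P) =
  map (map₂ (suc k ∷_)) (strips P) ++ map (λ p → suc (proj₁ p) , k ∷ proj₂ p) (strips P)

#nonzero : List ℕ → ℕ
#nonzero []          = 0
#nonzero (zero  ∷ P) = #nonzero P
#nonzero (suc k ∷ P) = suc (#nonzero P)

∑-strips : ∀ P g → ∑ (strips P) (g ∘ proj₁) ≡ ∑-choose (#nonzero P) g
∑-strips []          g = ℤ.+-identityʳ (g 0)
∑-strips (zero  ∷ P) g = trans (∑-map _ (strips P) (g ∘ proj₁)) (∑-strips P g)
∑-strips (suc k ∷ P) g = trans (∑-++ (map _ (strips P)) _ (g ∘ proj₁)) (cong₂ _+_
  (trans (∑-map _ (strips P) (g ∘ proj₁)) (∑-strips P g))
  (trans (∑-map _ (strips P) (g ∘ proj₁)) (∑-strips P (g ∘ suc))))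

strips-sum : ∀ P {p} → p ∈ strips P → proj₁ p ℕ.+ ℕ.sum (proj₂ p) ≡ ℕ.sum P
strips-sum []          (here refl) = refl
strips-sum (zero  ∷ P) p∈ with ∈-map⁻ _ p∈
... | q , q∈ , refl = strips-sum P q∈
strips-sum (suc k ∷ P) p∈ with ∈-++⁻ (map (map₂ (suc k ∷_)) (strips P)) p∈
... | inj₁ p∈₁ with q , q∈ , refl ← ∈-map⁻ _ p∈₁ =
  trans (ℕ+.x∙yz≈y∙xz (proj₁ q) (suc k) _) (cong (suc k ℕ.+_) (strips-sum P q∈))
... | inj₂ p∈₂ with q , q∈ , refl ← ∈-map⁻ _ p∈₂ =
  cong suc (trans (ℕ+.x∙yz≈y∙xz (proj₁ q) k _) (cong (k ℕ.+_) (strips-sum P q∈)))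

⊗-∷ : ∀ (f g : Series) {N} a (α : Vec ℕ N) → (f ⊗ g) (a ∷ α) ≡
  ∑ (upTo (suc a)) λ i → ∑ (splittings α) λ p → f (i ∷ proj₁ p) * g ((a ∸ i) ∷ proj₂ p)
⊗-∷ f g a α = ∑-cartesianProductWith _ (upTo (suc a)) (splittings α) _

e-0-suc∷ : ∀ i {N} (β : Vec ℕ N) → e 0 (suc i ∷ β) ≡ 0ℤ
e-0-suc∷ i β = cong (if_then 1ℤ else 0ℤ) (∧-zeroʳ (does (VecAll.all? (_≤? 1) (suc i ∷ β))))

eProduct-[] : ∀ P → eProduct P [] ≡ ⟦ #nonzero P ≟ 0 ⟧
eProduct-[] []          = refl
eProduct-[] (zero  ∷ P) = trans (trans (ℤ.+-identityʳ _) (ℤ.*-identityˡ _)) (eProduct-[] P)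
eProduct-[] (suc k ∷ P) = refl

-- Separating x₁ turns e_k into e_k + x₁ e_(k-1) in the other variables for k ≥ 1, while e_0 stays
-- 1. Hence x₁^a arises by lowering a nonzero parts by one.
eProduct-∷ : ∀ P {N} a (α : Vec ℕ N) →
  eProduct P (a ∷ α) ≡ ∑ (strips P) λ p → ⟦ proj₁ p ≟ a ⟧ * eProduct (proj₂ p) α

-- The exponent of x₁ in the first factor is already settled, and all of x₁^a comes from `P`. This
-- serves both possible exponents, 0 and 1, in the first factor.
e⊗eProduct-∷ : ∀ k P {N} a (α : Vec ℕ N) →
  ∑ (splittings α) (λ p → e k (proj₁ p) * eProduct P (a ∷ proj₂ p)) ≡
  ∑ (strips P) (λ q → ⟦ proj₁ q ≟ a ⟧ * eProduct (k ∷ proj₂ q) α)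
e⊗eProduct-∷ k P a α = begin
  ∑ (splittings α) (λ p → e k (proj₁ p) * eProduct P (a ∷ proj₂ p))
    ≡⟨ ∑-cong (splittings α) (λ p → trans (cong (e k (proj₁ p) *_) (eProduct-∷ P a (proj₂ p)))
         (trans (sym (∑-*ˡ (strips P) (e k (proj₁ p)) _))
         (∑-cong (strips P) λ q → ℤ*.x∙yz≈y∙xz (e k (proj₁ p)) ⟦ proj₁ q ≟ a ⟧ _))) ⟩
  ∑ (splittings α) (λ p → ∑ (strips P) λ q →
    ⟦ proj₁ q ≟ a ⟧ * (e k (proj₁ p) * eProduct (proj₂ q) (proj₂ p)))
    ≡⟨ ∑-swap (splittings α) (strips P) _ ⟩
  ∑ (strips P) (λ q → ∑ (splittings α) λ p →
    ⟦ proj₁ q ≟ a ⟧ * (e k (proj₁ p) * eProduct (proj₂ q) (proj₂ p)))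
    ≡⟨ ∑-cong (strips P) (λ q → ∑-*ˡ (splittings α) ⟦ proj₁ q ≟ a ⟧ _) ⟩
  ∑ (strips P) (λ q → ⟦ proj₁ q ≟ a ⟧ * eProduct (k ∷ proj₂ q) α) ∎

eProduct-∷ []      a α with 0 ≟ a
... | yes refl = sym (trans (ℤ.+-identityʳ _) (ℤ.*-identityˡ _))
eProduct-∷ []      zero    α | no 0≢a = sym (trans (ℤ.+-identityʳ _) (ℤ.*-identityˡ _))
eProduct-∷ []      (suc a) α | no 0≢a = refl
eProduct-∷ (k ∷ P) a α = begin
  eProduct (k ∷ P) (a ∷ α)
    ≡⟨ ⊗-∷ (e k) (eProduct P) a α ⟩
  ∑ (upTo (suc a)) (term k a)
    ≡⟨ ∑-upTo-suc a (term k a) ⟩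
  ∑ (splittings α) (λ p → e k (proj₁ p) * eProduct P (a ∷ proj₂ p)) + ∑ (upTo a) (term k a ∘ suc)
    ≡⟨ cong₂ _+_ (e⊗eProduct-∷ k P a α) refl ⟩
  ∑ (strips P) (λ q → ⟦ proj₁ q ≟ a ⟧ * eProduct (k ∷ proj₂ q) α) + ∑ (upTo a) (term k a ∘ suc)
    ≡⟨ parts k a ⟩
  ∑ (strips (k ∷ P)) (λ p → ⟦ proj₁ p ≟ a ⟧ * eProduct (proj₂ p) α) ∎
  where
  term : ℕ → ℕ → ℕ → ℤ
  term k a i = ∑ (splittings α) λ p → e k (i ∷ proj₁ p) * eProduct P ((a ∸ i) ∷ proj₂ p)

  higher : ∀ k a → ∑ (upTo a) (λ i → term (suc k) (suc a) (suc (suc i))) ≡ 0ℤ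
  higher k a = ∑-zero (upTo a) (λ _ → ∑-zero (splittings α) (λ _ → refl))

  second : ∀ k a → ∑ (upTo a) (term (suc k) a ∘ suc) ≡
    ∑ (strips P) (λ q → ⟦ suc (proj₁ q) ≟ a ⟧ * eProduct (k ∷ proj₂ q) α)
  second k zero    = sym (∑-zero (strips P) (λ _ → refl))
  second k (suc a) = begin
    ∑ (upTo (suc a)) (term (suc k) (suc a) ∘ suc)
      ≡⟨ ∑-upTo-suc a (term (suc k) (suc a) ∘ suc) ⟩
    term (suc k) (suc a) 1 + ∑ (upTo a) (λ i → term (suc k) (suc a) (suc (suc i)))
      -- With exponent 1 at x₁, `e (suc k)` computes to `e k` on the other variables; with a larger
      -- exponent it is 0.
      ≡⟨ cong₂ _+_ (e⊗eProduct-∷ k P a α) (higher k a) ⟩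
    ∑ (strips P) (λ q → ⟦ proj₁ q ≟ a ⟧ * eProduct (k ∷ proj₂ q) α) + 0ℤ
      ≡⟨ ℤ.+-identityʳ _ ⟩
    ∑ (strips P) (λ q → ⟦ proj₁ q ≟ a ⟧ * eProduct (k ∷ proj₂ q) α) ∎

  parts : ∀ k a →
    ∑ (strips P) (λ q → ⟦ proj₁ q ≟ a ⟧ * eProduct (k ∷ proj₂ q) α) + ∑ (upTo a) (term k a ∘ suc) ≡
    ∑ (strips (k ∷ P)) (λ p → ⟦ proj₁ p ≟ a ⟧ * eProduct (proj₂ p) α)
  parts zero a = begin
    body₀ + ∑ (upTo a) (term 0 a ∘ suc)
      ≡⟨ cong (_+_ body₀) (∑-zero (upTo a) (λ {i} _ → ∑-zero (splittings α) (λ {p} _ →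
           cong (_* eProduct P ((a ∸ suc i) ∷ proj₂ p)) (e-0-suc∷ i (proj₁ p))))) ⟩
    body₀ + 0ℤ
      ≡⟨ ℤ.+-identityʳ body₀ ⟩
    body₀
      ≡⟨ ∑-map (map₂ (0 ∷_)) (strips P) _ ⟨
    ∑ (strips (zero ∷ P)) (λ p → ⟦ proj₁ p ≟ a ⟧ * eProduct (proj₂ p) α) ∎
    where
    body₀ : ℤ
    body₀ = ∑ (strips P) (λ q → ⟦ proj₁ q ≟ a ⟧ * eProduct (0 ∷ proj₂ q) α)
  parts (suc k) a = begin
    ∑ (strips P) (λ q → ⟦ proj₁ q ≟ a ⟧ * eProduct (suc k ∷ proj₂ q) α) + ∑ (upTo a) (term (suc k) a ∘ suc)
      ≡⟨ cong₂ _+_ (sym (∑-map (map₂ (suc k ∷_)) (strips P) body))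
                   (trans (second k a) (sym (∑-map shift (strips P) body))) ⟩
    ∑ (map (map₂ (suc k ∷_)) (strips P)) body + ∑ (map shift (strips P)) body
      ≡⟨ ∑-++ (map (map₂ (suc k ∷_)) (strips P)) (map shift (strips P)) body ⟨
    ∑ (strips (suc k ∷ P)) body ∎
    where
    body : ℕ × List ℕ → ℤ
    body p = ⟦ proj₁ p ≟ a ⟧ * eProduct (proj₂ p) α
    shift : ℕ × List ℕ → ℕ × List ℕ
    shift p = suc (proj₁ p) , k ∷ proj₂ p

-- Hooks detected among partitions by strips.

infix 4 _≟ᴸ_

_≟ᴸ_ : DecidableEquality (List ℕ)
_≟ᴸ_ = ≡-dec _≟_

ones : ℕ → List ℕ
ones q = replicate q 1

sum-ones : ∀ q → ℕ.sum (ones q) ≡ q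
sum-ones zero    = refl
sum-ones (suc q) = cong suc (sum-ones q)

-- A strip lowers each part by at most one, so positive parts all reach 0 only if each of them is 1
-- and is lowered.
∑-strips-0 : ∀ P (g : ℕ → ℤ) → All (1 ≤_) P →
  ∑ (strips P) (λ p → g (proj₁ p) * ⟦ #nonzero (proj₂ p) ≟ 0 ⟧) ≡
  ⟦ P ≟ᴸ ones (length P) ⟧ * g (length P)
∑-strips-0 []               g []       = trans (ℤ.+-identityʳ (g 0 * 1ℤ)) (ℤ.*-comm (g 0) 1ℤ)
∑-strips-0 (suc zero ∷ P)    g (_ ∷ ps) = begin
  ∑ (strips (1 ∷ P)) body
    ≡⟨ ∑-++ (map (map₂ (1 ∷_)) (strips P)) _ body ⟩
  ∑ (map (map₂ (1 ∷_)) (strips P)) body + ∑ (map (λ p → suc (proj₁ p) , 0 ∷ proj₂ p) (strips P)) body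
    ≡⟨ cong₂ _+_ (trans (∑-map _ (strips P) body) (∑-zero (strips P) (λ {p} _ → ℤ.*-zeroʳ (g (proj₁ p)))))
                 (trans (∑-map _ (strips P) body) (∑-strips-0 P (g ∘ suc) ps)) ⟩
  0ℤ + ⟦ P ≟ᴸ ones (length P) ⟧ * g (suc (length P))
    ≡⟨ ℤ.+-identityˡ _ ⟩
  ⟦ P ≟ᴸ ones (length P) ⟧ * g (suc (length P))
    ≡⟨ cong (_* g (suc (length P))) (⟦⟧-cong (P ≟ᴸ ones (length P)) ((1 ∷ P) ≟ᴸ (1 ∷ ones (length P))) (cong (1 ∷_)) ∷-injectiveʳ) ⟩
  ⟦ (1 ∷ P) ≟ᴸ (1 ∷ ones (length P)) ⟧ * g (suc (length P)) ∎
  where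
  body : ℕ × List ℕ → ℤ
  body p = g (proj₁ p) * ⟦ #nonzero (proj₂ p) ≟ 0 ⟧
∑-strips-0 (suc (suc k) ∷ P) g (_ ∷ ps) = begin
  ∑ (strips (suc (suc k) ∷ P)) body
    ≡⟨ ∑-++ (map (map₂ (suc (suc k) ∷_)) (strips P)) _ body ⟩
  ∑ (map (map₂ (suc (suc k) ∷_)) (strips P)) body + ∑ (map (λ p → suc (proj₁ p) , suc k ∷ proj₂ p) (strips P)) body
    ≡⟨ cong₂ _+_ (trans (∑-map _ (strips P) body) (∑-zero (strips P) (λ {p} _ → ℤ.*-zeroʳ (g (proj₁ p)))))
                 (trans (∑-map _ (strips P) body) (∑-zero (strips P) (λ {p} _ → ℤ.*-zeroʳ (g (suc (proj₁ p)))))) ⟩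
  0ℤ
    ≡⟨ cong (_* g (suc (length P))) (⟦⟧-false ((suc (suc k) ∷ P) ≟ᴸ (1 ∷ ones (length P))) (λ ())) ⟨
  ⟦ (suc (suc k) ∷ P) ≟ᴸ (1 ∷ ones (length P)) ⟧ * g (suc (length P)) ∎
  where
  body : ℕ × List ℕ → ℤ
  body p = g (proj₁ p) * ⟦ #nonzero (proj₂ p) ≟ 0 ⟧

-- Split on the first part. If it is kept, it is the surviving part and the others must reach 0; if
-- it is lowered, its survival depends on `k`.
∑-strips-1 : ∀ k P (g : ℕ → ℤ) →
  ∑ (strips (suc k ∷ P)) (λ p → g (proj₁ p) * ⟦ #nonzero (proj₂ p) ≟ 1 ⟧) ≡
  ∑ (strips P) (λ p → g (proj₁ p) * ⟦ #nonzero (proj₂ p) ≟ 0 ⟧) +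
  ∑ (strips P) (λ p → g (suc (proj₁ p)) * ⟦ #nonzero (k ∷ proj₂ p) ≟ 1 ⟧)
∑-strips-1 k P g = trans
  (∑-++ (map (map₂ (suc k ∷_)) (strips P)) _ body)
  (cong₂ _+_ (∑-map _ (strips P) body) (∑-map _ (strips P) body))
  where
  body : ℕ × List ℕ → ℤ
  body p = g (proj₁ p) * ⟦ #nonzero (proj₂ p) ≟ 1 ⟧

∑-strips-0-ones : ∀ q (g : ℕ → ℤ) →
  ∑ (strips (ones q)) (λ p → g (proj₁ p) * ⟦ #nonzero (proj₂ p) ≟ 0 ⟧) ≡ g q
∑-strips-0-ones q g = begin
  _ ≡⟨ ∑-strips-0 (ones q) g (All.replicate⁺ q (s≤s z≤n)) ⟩
  ⟦ ones q ≟ᴸ ones (length (ones q)) ⟧ * g (length (ones q))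
    ≡⟨ cong₂ _*_ (⟦⟧-true (ones q ≟ᴸ ones (length (ones q))) (cong ones (sym (length-replicate q))))
                 (cong g (length-replicate q)) ⟩
  1ℤ * g q ≡⟨ ℤ.*-identityˡ (g q) ⟩
  g q ∎

-- One of the q ones is kept and the other q - 1 are lowered, in q ways. For q = 0 the default
-- `ℕ.pred 0` is harmless, being multiplied by 0.
∑-strips-1-ones : ∀ q (g : ℕ → ℤ) →
  ∑ (strips (ones q)) (λ p → g (proj₁ p) * ⟦ #nonzero (proj₂ p) ≟ 1 ⟧) ≡ + q * g (ℕ.pred q)
∑-strips-1-ones zero          g = trans (ℤ.+-identityʳ _) (ℤ.*-zeroʳ (g 0))
∑-strips-1-ones (suc q)       g = begin
  _ ≡⟨ ∑-strips-1 0 (ones q) g ⟩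
  _ ≡⟨ cong₂ _+_ (∑-strips-0-ones q g) (∑-strips-1-ones q (g ∘ suc)) ⟩
  g q + + q * g (suc (ℕ.pred q)) ≡⟨ collect q ⟩
  + suc q * g q ∎
  where
  collect′ : ∀ x y → y + x * y ≡ (1ℤ + x) * y
  collect′ = solve-∀
  collect : ∀ q → g q + + q * g (suc (ℕ.pred q)) ≡ + suc q * g q
  collect zero    = trans (ℤ.+-identityʳ (g 0)) (sym (ℤ.*-identityˡ (g 0)))
  collect (suc q) = collect′ (+ suc q) (g (suc q))

σ-diagonal : ∀ r → σ r r ≡ 1ℤ
σ-diagonal zero    = refl
σ-diagonal (suc r) = σ-diagonal r

σ-above : ∀ {r k} → r < k → σ r k ≡ 0ℤ
σ-above {zero}  {suc k} _         = refl
σ-above {suc r} {suc k} (s≤s r<k) = σ-above r<k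

sorted-from-1 : ∀ P → Linked _≥_ (1 ∷ P) → All (1 ≤_) P → P ≡ ones (length P)
sorted-from-1 []                _                    []       = refl
sorted-from-1 (suc zero ∷ P)    (s≤s z≤n ∷ sorted) (_ ∷ ps) = cong (1 ∷_) (sorted-from-1 P sorted ps)
sorted-from-1 (suc (suc _) ∷ P) (s≤s () ∷ _)       (_ ∷ ps)

hook : ℕ → ℕ → List ℕ
hook m r = m ∷ ones r

hook-isPartition : ∀ m r → 1 ≤ m → IsPartition (m ℕ.+ r) (hook m r)
hook-isPartition m r 1≤m =
  sorted m r 1≤m , 1≤m ∷ All.replicate⁺ r (s≤s z≤n) , cong (m ℕ.+_) (sum-ones r)
  where
  sorted : ∀ m r → 1 ≤ m → Linked _≥_ (hook m r)
  sorted m zero    _   = [-]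
  sorted m (suc r) 1≤m = 1≤m ∷ sorted 1 r (s≤s z≤n)

-- The n comes from e_1^n: any one of its n factors can be the one that is not stripped first.
weight : ℕ → ℕ → ℤ
weight (suc zero) n = + n
weight _          n = 1ℤ

-- A sorted partition starting with 1 consists of ones, and `∑-strips-1-ones` applies. A first part
-- of at least 2 survives whether lowered or not, so the q other parts must all be lowered from 1 to
-- 0. The two options together weigh `σ r q + σ r (suc q)`, which is 1 for q = r and 0 otherwise;
-- the size then fixes the first part.
∑-strips-hook : ∀ m r λs → 1 ≤ m → IsPartition (m ℕ.+ r) λs →
  ∑ (strips λs) (λ p → σ r (proj₁ p) * ⟦ #nonzero (proj₂ p) ≟ 1 ⟧) ≡
  weight m (m ℕ.+ r) * ⟦ λs ≟ᴸ hook m r ⟧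
∑-strips-hook (suc m) r [] _ (_ , _ , ())
∑-strips-hook m r (zero ∷ P) _ (_ , () ∷ _ , _)
∑-strips-hook m r (suc zero ∷ P) 1≤m (sorted , _ ∷ ps , sum≡) = begin
  _ ≡⟨ cong (λ Q → ∑ (strips Q) (λ p → σ r (proj₁ p) * ⟦ #nonzero (proj₂ p) ≟ 1 ⟧)) (cong (1 ∷_) P≡) ⟩
  ∑ (strips (ones (suc q))) (λ p → σ r (proj₁ p) * ⟦ #nonzero (proj₂ p) ≟ 1 ⟧)
    ≡⟨ ∑-strips-1-ones (suc q) (σ r) ⟩
  + suc q * σ r q
    ≡⟨ case m 1≤m (trans (sym (cong suc (trans (cong ℕ.sum P≡) (sum-ones q)))) sum≡) ⟩
  weight m (m ℕ.+ r) * ⟦ ones (suc q) ≟ᴸ hook m r ⟧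
    ≡⟨ cong (λ Q → weight m (m ℕ.+ r) * ⟦ Q ≟ᴸ hook m r ⟧) (cong (1 ∷_) P≡) ⟨
  weight m (m ℕ.+ r) * ⟦ (1 ∷ P) ≟ᴸ hook m r ⟧ ∎
  where
  q : ℕ
  q = length P
  P≡ : P ≡ ones q
  P≡ = sorted-from-1 P sorted ps
  case : ∀ m → 1 ≤ m → suc q ≡ m ℕ.+ r →
    + suc q * σ r q ≡ weight m (m ℕ.+ r) * ⟦ ones (suc q) ≟ᴸ hook m r ⟧
  case (suc zero)    _ refl = cong (+ suc r *_)
    (trans (σ-diagonal r) (sym (⟦⟧-true (ones (suc r) ≟ᴸ ones (suc r)) refl)))
  -- Here q exceeds r, which lies beyond the support of `σ r`, and a list of ones is not a hook with
  -- first part at least 2.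
  case (suc (suc m)) _ eq =
    trans (cong (+ suc q *_) (σ-above (ℕ.≤-trans (s≤s (ℕ.m≤n+m r m)) (ℕ.≤-reflexive (sym (ℕ.suc-injective eq))))))
    (trans (ℤ.*-zeroʳ (+ suc q))
    (sym (trans (ℤ.*-identityˡ _) (⟦⟧-false (ones (suc q) ≟ᴸ hook (suc (suc m)) r) (λ ())))))
∑-strips-hook m r (suc (suc k) ∷ P) 1≤m (_ , _ ∷ ps , sum≡) = begin
  _ ≡⟨ ∑-strips-1 (suc k) P (σ r) ⟩
  _ ≡⟨ cong₂ _+_ (∑-strips-0 P (σ r) ps) (∑-strips-0 P (σ r ∘ suc) ps) ⟩
  ⟦ P≟ ⟧ * σ r q + ⟦ P≟ ⟧ * σ r (suc q)
    ≡⟨ ℤ.*-distribˡ-+ ⟦ P≟ ⟧ (σ r q) (σ r (suc q)) ⟨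
  ⟦ P≟ ⟧ * (σ r q + σ r (suc q))
    ≡⟨ cong (⟦ P≟ ⟧ *_) (σ-telescope r q) ⟩
  ⟦ P≟ ⟧ * ⟦ q ≟ r ⟧
    ≡⟨ ⟦⟧-× P≟ (q ≟ r) ⟨
  ⟦ P≟ ×-dec (q ≟ r) ⟧
    ≡⟨ ⟦⟧-cong (P≟ ×-dec (q ≟ r)) (suc (suc k) ∷ P ≟ᴸ hook m r) to from ⟩
  ⟦ suc (suc k) ∷ P ≟ᴸ hook m r ⟧
    ≡⟨ weightless m sum≡ ⟩
  weight m (m ℕ.+ r) * ⟦ suc (suc k) ∷ P ≟ᴸ hook m r ⟧ ∎
  where
  q : ℕ
  q = length P
  P≟ : Dec (P ≡ ones q)
  P≟ = P ≟ᴸ ones q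
  to : P ≡ ones q × q ≡ r → suc (suc k) ∷ P ≡ hook m r
  to (P≡ , refl) = cong₂ _∷_
    (ℕ.+-cancelʳ-≡ q (suc (suc k)) m
      (trans (cong (suc (suc k) ℕ.+_) (sym (trans (cong ℕ.sum P≡) (sum-ones q)))) sum≡))
    P≡
  from : suc (suc k) ∷ P ≡ hook m r → P ≡ ones q × q ≡ r
  from refl = cong ones (sym (length-replicate r)) , length-replicate r
  weightless : ∀ m → suc (suc k) ℕ.+ ℕ.sum P ≡ m ℕ.+ r →
    ⟦ suc (suc k) ∷ P ≟ᴸ hook m r ⟧ ≡ weight m (m ℕ.+ r) * ⟦ suc (suc k) ∷ P ≟ᴸ hook m r ⟧
  weightless zero          _ = sym (ℤ.*-identityˡ _)
  -- The weight is n here, but the indicator that it multiplies is 0 because the first parts differ.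
  weightless (suc zero)    _ = trans no-hook (sym (trans (cong (+ suc r *_) no-hook) (ℤ.*-zeroʳ (+ suc r))))
    where
    no-hook : ⟦ suc (suc k) ∷ P ≟ᴸ hook 1 r ⟧ ≡ 0ℤ
    no-hook = ⟦⟧-false (suc (suc k) ∷ P ≟ᴸ hook 1 r) (λ ())
  weightless (suc (suc m)) _ = sym (ℤ.*-identityˡ _)

-- Each partition is enumerated exactly once.

∑-words-toList : ∀ {N} μs k → All (_< N) μs →
  ∑ (words (upTo N) k) (λ w → ⟦ Vec.toList w ≟ᴸ μs ⟧) ≡ ⟦ length μs ≟ k ⟧
∑-words-toList []       zero    []           = refl
∑-words-toList {N} []   (suc k) []           = trans
  (∑-cartesianProductWith _ (upTo N) (words (upTo N) k) _)
  (∑-zero (upTo N) (λ _ → ∑-zero (words (upTo N) k) (λ _ → refl)))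
∑-words-toList (x ∷ μs) zero    _            = refl
∑-words-toList {N} (x ∷ μs) (suc k) (x<N ∷ μs<N) = begin
  ∑ (words (upTo N) (suc k)) (λ w → ⟦ Vec.toList w ≟ᴸ x ∷ μs ⟧)
    ≡⟨ ∑-cartesianProductWith _ (upTo N) (words (upTo N) k) _ ⟩
  ∑ (upTo N) (λ a → ∑ (words (upTo N) k) λ w → ⟦ a ∷ Vec.toList w ≟ᴸ x ∷ μs ⟧)
    ≡⟨ ∑-cong (upTo N) (λ a → trans
         (∑-cong (words (upTo N) k) (λ w → trans
            (⟦⟧-cong (a ∷ Vec.toList w ≟ᴸ x ∷ μs) ((x ≟ a) ×-dec (Vec.toList w ≟ᴸ μs))
              (λ eq → sym (∷-injectiveˡ eq) , ∷-injectiveʳ eq) (λ (x≡a , w≡μ) → cong₂ _∷_ (sym x≡a) w≡μ))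
            (⟦⟧-× (x ≟ a) (Vec.toList w ≟ᴸ μs))))
         (trans (∑-*ˡ (words (upTo N) k) ⟦ x ≟ a ⟧ _) (cong (⟦ x ≟ a ⟧ *_) (∑-words-toList μs k μs<N)))) ⟩
  ∑ (upTo N) (λ a → ⟦ x ≟ a ⟧ * ⟦ length μs ≟ k ⟧)
    ≡⟨ ∑-upTo-δ x<N (λ _ → ⟦ length μs ≟ k ⟧) ⟩
  ⟦ length μs ≟ k ⟧ ∎

parts≤sum : ∀ μs → All (_≤ ℕ.sum μs) μs
parts≤sum []       = []
parts≤sum (x ∷ μs) = ℕ.m≤m+n x _ ∷ All.map (λ y≤ → ℕ.≤-trans y≤ (ℕ.m≤n+m _ x)) (parts≤sum μs)

length≤sum : ∀ {μs} → All (1 ≤_) μs → length μs ≤ ℕ.sum μs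
length≤sum []         = z≤n
length≤sum (1≤x ∷ ps) = ℕ.+-mono-≤ 1≤x (length≤sum ps)

-- The enumeration runs through words of length at most n in letters at most n. The size bounds the
-- parts, and positivity of the parts bounds the length, so `μs` is reached, by a single word.
∑-partitions-δ : ∀ {n μs} → IsPartition n μs → (f : List ℕ → ℤ) →
  ∑ (partitions n) (λ λs → ⟦ λs ≟ᴸ μs ⟧ * f λs) ≡ f μs
∑-partitions-δ {n} {μs} μ-part@(_ , μ≥1 , refl) f = begin
  ∑ (partitions n) (λ λs → ⟦ λs ≟ᴸ μs ⟧ * f λs)
    ≡⟨ ∑-filter (isPartition? n) (concatMap lists (upTo (suc n))) (λ λs → ⟦ λs ≟ᴸ μs ⟧ * f λs) ⟩
  ∑ (concatMap lists (upTo (suc n))) (λ λs → ⟦ isPartition? n λs ⟧ * (⟦ λs ≟ᴸ μs ⟧ * f λs))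
    ≡⟨ ∑-cong (concatMap lists (upTo (suc n))) pointwise ⟩
  ∑ (concatMap lists (upTo (suc n))) (λ λs → ⟦ λs ≟ᴸ μs ⟧ * f μs)
    ≡⟨ ∑-*ʳ (concatMap lists (upTo (suc n))) (f μs) (λ λs → ⟦ λs ≟ᴸ μs ⟧) ⟩
  ∑ (concatMap lists (upTo (suc n))) (λ λs → ⟦ λs ≟ᴸ μs ⟧) * f μs
    ≡⟨ cong (_* f μs) once ⟩
  1ℤ * f μs
    ≡⟨ ℤ.*-identityˡ (f μs) ⟩
  f μs ∎
  where
  lists : ℕ → List (List ℕ)
  lists k = map Vec.toList (words (upTo (suc n)) k)
  pointwise : ∀ λs → ⟦ isPartition? n λs ⟧ * (⟦ λs ≟ᴸ μs ⟧ * f λs) ≡ ⟦ λs ≟ᴸ μs ⟧ * f μs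
  pointwise λs with λs ≟ᴸ μs
  ... | yes refl = trans (cong (_* (1ℤ * f μs)) (⟦⟧-true (isPartition? n μs) μ-part)) (ℤ.*-identityˡ _)
  ... | no  _    = ℤ.*-zeroʳ ⟦ isPartition? n λs ⟧
  once : ∑ (concatMap lists (upTo (suc n))) (λ λs → ⟦ λs ≟ᴸ μs ⟧) ≡ 1ℤ
  once = begin
    ∑ (concatMap lists (upTo (suc n))) (λ λs → ⟦ λs ≟ᴸ μs ⟧)
      ≡⟨ ∑-concatMap lists (upTo (suc n)) (λ λs → ⟦ λs ≟ᴸ μs ⟧) ⟩
    ∑ (upTo (suc n)) (λ k → ∑ (lists k) (λ λs → ⟦ λs ≟ᴸ μs ⟧))
      ≡⟨ ∑-cong (upTo (suc n)) (λ k → trans (∑-map Vec.toList (words (upTo (suc n)) k) (λ λs → ⟦ λs ≟ᴸ μs ⟧))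
           (trans (∑-words-toList μs k (All.map s≤s (parts≤sum μs))) (sym (ℤ.*-identityʳ _)))) ⟩
    ∑ (upTo (suc n)) (λ k → ⟦ length μs ≟ k ⟧ * 1ℤ)
      ≡⟨ ∑-upTo-δ (s≤s (length≤sum μ≥1)) (λ _ → 1ℤ) ⟩
    1ℤ ∎

-- The functional that extracts hook coefficients.

-- Up to the weight, this reads off the coefficient of e_(m,1^r) in degree n = m + r.
hookFunctional : ℕ → ℕ → Series → ℤ
hookFunctional n r f = T n n (D n aμ (D n (σ r) f))

hookFunctional-cong : ∀ n r {f h : Series} → f ≈ h → hookFunctional n r f ≡ hookFunctional n r h
hookFunctional-cong n r {f} {h} f≈h =
  T-cong n n {D n aμ (D n (σ r) f)} {D n aμ (D n (σ r) h)}
    (D-cong n aμ {D n (σ r) f} {D n (σ r) h} (D-cong n (σ r) {f} {h} f≈h))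

module _ {A : Set} (n : ℕ) (g : ℕ → ℤ) (xs : List A) (c : A → ℤ) (F : A → Series) where

  T-D-∑ : ∀ M → T n M (D n g (λ α → ∑ xs λ x → c x * F x α)) ≡ ∑ xs λ x → c x * T n M (D n g (F x))
  T-D-∑ M = trans
    (T-cong n M {D n g (λ α → ∑ xs λ x → c x * F x α)} {λ α → ∑ xs λ x → c x * D n g (F x) α} (D-∑ n g xs c F))
    (T-∑ n M xs c (λ x → D n g (F x)))

hookFunctional-∑ : ∀ {A : Set} n r (xs : List A) (c : A → ℤ) (F : A → Series) →
  hookFunctional n r (λ α → ∑ xs λ x → c x * F x α) ≡ ∑ xs λ x → c x * hookFunctional n r (F x)
hookFunctional-∑ n r xs c F = trans
  (T-cong n n {D n aμ (D n (σ r) f)} {D n aμ f′} (D-cong n aμ {D n (σ r) f} {f′} (D-∑ n (σ r) xs c F)))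
  (T-D-∑ n aμ xs c (λ x → D n (σ r) (F x)) n)
  where
  f f′ : Series
  f  α = ∑ xs λ x → c x * F x α
  f′ α = ∑ xs λ x → c x * D n (σ r) (F x) α

-- The first variable strips parts with weight `σ r`. By `T-D-strip` and `∑-choose-aμ`, the other
-- variables then contribute 1 if exactly one nonzero part is left and 0 otherwise.
hookFunctional-eProduct : ∀ m r λs → 1 ≤ m → IsPartition (m ℕ.+ r) λs →
  hookFunctional (m ℕ.+ r) r (eProduct λs) ≡ weight m (m ℕ.+ r) * ⟦ λs ≟ᴸ hook m r ⟧
hookFunctional-eProduct m r λs 1≤m λ-part@(_ , _ , sum≡) = begin
  T d d (D d aμ (D d (σ r) (eProduct λs)))
    ≡⟨ T-cong d d {D d aμ (D d (σ r) (eProduct λs))} {D d aμ f}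
         (D-cong d aμ {D d (σ r) (eProduct λs)} {f} (λ α →
           D-graded d (σ r) {eProduct λs} α (strips λs) proj₁ (λ p → eProduct (proj₂ p) α)
             (λ p∈ → ℕ.≤-trans (ℕ.m≤m+n _ _) (bound p∈)) (λ a → eProduct-∷ λs a α))) ⟩
  T d d (D d aμ f)
    ≡⟨ T-D-∑ d aμ (strips λs) (σ r ∘ proj₁) (eProduct ∘ proj₂) d ⟩
  ∑ (strips λs) (λ p → σ r (proj₁ p) * T d d (D d aμ (eProduct (proj₂ p))))
    ≡⟨ ∑-cong-∈ (strips λs) (λ {p} p∈ → let Q≤d = ℕ.≤-trans (ℕ.m≤n+m _ (proj₁ p)) (bound p∈) in
         cong (σ r (proj₁ p) *_)
         (trans (T-D-strip d eProduct strips #nonzero ℕ.sum eProduct-[] eProduct-∷ ∑-strips strips-sum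
                  d aμ (proj₂ p) refl Q≤d Q≤d)
                (∑-choose-aμ (#nonzero (proj₂ p))))) ⟩
  ∑ (strips λs) (λ p → σ r (proj₁ p) * ⟦ #nonzero (proj₂ p) ≟ 1 ⟧)
    ≡⟨ ∑-strips-hook m r λs 1≤m λ-part ⟩
  weight m (m ℕ.+ r) * ⟦ λs ≟ᴸ hook m r ⟧ ∎
  where
  d : ℕ
  d = m ℕ.+ r
  f : Series
  f α = ∑ (strips λs) λ p → σ r (proj₁ p) * eProduct (proj₂ p) α
  bound : ∀ {p} → p ∈ strips λs → proj₁ p ℕ.+ ℕ.sum (proj₂ p) ≤ d
  bound p∈ = ℕ.≤-reflexive (trans (strips-sum λs p∈) sum≡)

hookFunctional-expansion : ∀ m r → 1 ≤ m → (f : Series) (c : List ℕ → ℤ) →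
  IsEExpansion (m ℕ.+ r) f c →
  hookFunctional (m ℕ.+ r) r f ≡ weight m (m ℕ.+ r) * c (hook m r)
hookFunctional-expansion m r 1≤m f c f≈ = begin
  hookFunctional d r f
    ≡⟨ hookFunctional-cong d r {f} {λ α → ∑ (partitions d) λ λs → c λs * eProduct λs α} f≈ ⟩
  hookFunctional d r (λ α → ∑ (partitions d) λ λs → c λs * eProduct λs α)
    ≡⟨ hookFunctional-∑ d r (partitions d) c eProduct ⟩
  ∑ (partitions d) (λ λs → c λs * hookFunctional d r (eProduct λs))
    ≡⟨ ∑-cong-∈ (partitions d) (λ {λs} λ∈ → trans
         (cong (c λs *_) (hookFunctional-eProduct m r λs 1≤m (proj₂ (∈-filter⁻ (isPartition? d) {xs = candidates} λ∈))))
         (rotate (c λs) (weight m d) ⟦ λs ≟ᴸ hook m r ⟧)) ⟩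
  ∑ (partitions d) (λ λs → ⟦ λs ≟ᴸ hook m r ⟧ * (weight m d * c λs))
    ≡⟨ ∑-partitions-δ (hook-isPartition m r 1≤m) (λ λs → weight m d * c λs) ⟩
  weight m d * c (hook m r) ∎
  where
  d : ℕ
  d = m ℕ.+ r
  candidates : List (List ℕ)
  candidates = concatMap (λ k → map Vec.toList (words (upTo (suc d)) k)) (upTo (suc d))
  rotate : ∀ x y z → x * (y * z) ≡ z * (y * x)
  rotate = solve-∀

-- Sums over subsets

subsets : Subset n → List (Subset n)
subsets []          = [] ∷ []
subsets (false ∷ S) = map (false ∷_) (subsets S)
subsets (true  ∷ S) = map (false ∷_) (subsets S) ++ map (true ∷_) (subsets S)

∑-subsets-card : ∀ (S : Subset n) g → ∑ (subsets S) (g ∘ ∣_∣) ≡ ∑-choose ∣ S ∣ g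
∑-subsets-card []          g = ℤ.+-identityʳ (g 0)
∑-subsets-card (false ∷ S) g = trans (∑-map (false ∷_) (subsets S) (g ∘ ∣_∣)) (∑-subsets-card S g)
∑-subsets-card (true  ∷ S) g = trans
  (∑-++ (map (false ∷_) (subsets S)) (map (true ∷_) (subsets S)) (g ∘ ∣_∣))
  (cong₂ _+_ (trans (∑-map (false ∷_) (subsets S) (g ∘ ∣_∣)) (∑-subsets-card S g))
             (trans (∑-map (true ∷_) (subsets S) (g ∘ ∣_∣)) (∑-subsets-card S (g ∘ suc))))

-- Serves to absorb a condition on the first color class into the range of summation.
∑-subsets-∩ : ∀ (S U : Subset n) (f : Subset n → ℤ) →
  ∑ (subsets S) (λ T → ⟦ T Subset.⊆? U ⟧ * f T) ≡ ∑ (subsets (S ∩ U)) f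
∑-subsets-∩ []          []      f = cong (_+ 0ℤ) (ℤ.*-identityˡ (f []))
∑-subsets-∩ (false ∷ S) (u ∷ U) f = begin
  ∑ (map (false ∷_) (subsets S)) (λ T → ⟦ T Subset.⊆? (u ∷ U) ⟧ * f T)
    ≡⟨ ∑-map (false ∷_) (subsets S) _ ⟩
  ∑ (subsets S) (λ T → ⟦ T Subset.⊆? U ⟧ * f (false ∷ T))
    ≡⟨ ∑-subsets-∩ S U (f ∘ (false ∷_)) ⟩
  ∑ (subsets (S ∩ U)) (f ∘ (false ∷_))
    ≡⟨ ∑-map (false ∷_) (subsets (S ∩ U)) f ⟨
  ∑ (map (false ∷_) (subsets (S ∩ U))) f ∎
∑-subsets-∩ (true  ∷ S) (u ∷ U) f = begin
  ∑ (map (false ∷_) (subsets S) ++ map (true ∷_) (subsets S)) (λ T → ⟦ T Subset.⊆? (u ∷ U) ⟧ * f T)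
    ≡⟨ ∑-++ (map (false ∷_) (subsets S)) (map (true ∷_) (subsets S)) _ ⟩
  ∑ (map (false ∷_) (subsets S)) (λ T → ⟦ T Subset.⊆? (u ∷ U) ⟧ * f T) +
  ∑ (map (true ∷_) (subsets S)) (λ T → ⟦ T Subset.⊆? (u ∷ U) ⟧ * f T)
    ≡⟨ cong₂ _+_ (trans (∑-map (false ∷_) (subsets S) _) (∑-subsets-∩ S U (f ∘ (false ∷_))))
                 (∑-map (true ∷_) (subsets S) _) ⟩
  ∑ (subsets (S ∩ U)) (f ∘ (false ∷_)) +
  ∑ (subsets S) (λ T → ⟦ (true ∷ T) Subset.⊆? (u ∷ U) ⟧ * f (true ∷ T))
    ≡⟨ rest u ⟩
  ∑ (subsets ((true ∷ S) ∩ (u ∷ U))) f ∎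
  where
  rest : ∀ u → ∑ (subsets (S ∩ U)) (f ∘ (false ∷_)) +
    ∑ (subsets S) (λ T → ⟦ (true ∷ T) Subset.⊆? (u ∷ U) ⟧ * f (true ∷ T)) ≡
    ∑ (subsets ((true ∷ S) ∩ (u ∷ U))) f
  rest false = trans
    (cong₂ _+_ (sym (∑-map (false ∷_) (subsets (S ∩ U)) f)) (∑-zero (subsets S) (λ _ → refl)))
    (ℤ.+-identityʳ _)
  rest true  = trans
    (cong₂ _+_ (sym (∑-map (false ∷_) (subsets (S ∩ U)) f))
               (trans (∑-subsets-∩ S U (f ∘ (true ∷_))) (sym (∑-map (true ∷_) (subsets (S ∩ U)) f))))
    (sym (∑-++ (map (false ∷_) (subsets (S ∩ U))) (map (true ∷_) (subsets (S ∩ U))) f))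

subsets⇒⊆ : ∀ (S : Subset n) {T} → T ∈ subsets S → T ⊆ S
subsets⇒⊆ []          (here refl) ()
subsets⇒⊆ (false ∷ S) T∈ with _ , T∈ , refl ← ∈-map⁻ (false ∷_) T∈ = Subset.s⊆s (subsets⇒⊆ S T∈)
subsets⇒⊆ (true ∷ S)  T∈ with ∈-++⁻ (map (false ∷_) (subsets S)) T∈
... | inj₁ T∈ with _ , T∈ , refl ← ∈-map⁻ (false ∷_) T∈ = Subset.out⊆ (subsets⇒⊆ S T∈)
... | inj₂ T∈ with _ , T∈ , refl ← ∈-map⁻ (true ∷_) T∈  = Subset.s⊆s (subsets⇒⊆ S T∈)

∣p∣+∣q─p∣≡∣q∣ : ∀ (p q : Subset n) → p ⊆ q → ∣ p ∣ ℕ.+ ∣ q ─ p ∣ ≡ ∣ q ∣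
∣p∣+∣q─p∣≡∣q∣ []          []          p⊆q = refl
∣p∣+∣q─p∣≡∣q∣ (false ∷ p) (false ∷ q) p⊆q = ∣p∣+∣q─p∣≡∣q∣ p q (Subset.drop-∷-⊆ p⊆q)
∣p∣+∣q─p∣≡∣q∣ (false ∷ p) (true  ∷ q) p⊆q =
  trans (ℕ.+-suc ∣ p ∣ _) (cong suc (∣p∣+∣q─p∣≡∣q∣ p q (Subset.drop-∷-⊆ p⊆q)))
∣p∣+∣q─p∣≡∣q∣ (true  ∷ p) (false ∷ q) p⊆q = contradiction (p⊆q Vec.here) λ ()
∣p∣+∣q─p∣≡∣q∣ (true  ∷ p) (true  ∷ q) p⊆q = cong suc (∣p∣+∣q─p∣≡∣q∣ p q (Subset.drop-∷-⊆ p⊆q))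

∈⇒∣p∣≢0 : ∀ {p : Subset n} {v} → v Subset.∈ p → ∣ p ∣ ≢ 0
∈⇒∣p∣≢0 v∈p ∣p∣≡0 = contradiction (ℕ.<-≤-trans (Subset.x∈p⇒∣p-x∣<∣p∣ v∈p) (ℕ.≤-reflexive ∣p∣≡0)) λ ()

∣Empty∣≡0 : ∀ (p : Subset n) → Subset.Empty p → ∣ p ∣ ≡ 0
∣Empty∣≡0 {n} p empty = trans (cong ∣_∣ (Subset.Empty-unique empty)) (Subset.∣⊥∣≡0 n)

-- Subsets cut out by decidable predicates.

module _ {P : Fin n → Set} (P? : Unary.Decidable P) where

  ⟪_⟫ : Subset n
  ⟪_⟫ = Vec.tabulate (does ∘ P?)

  ∈-⟪⟫⁺ : ∀ {v} → P v → v Subset.∈ ⟪_⟫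
  ∈-⟪⟫⁺ {v} p = Vec.lookup⇒[]= v ⟪_⟫ (trans (Vec.lookup∘tabulate _ v) (dec-true (P? v) p))

  ∈-⟪⟫⁻ : ∀ {v} → v Subset.∈ ⟪_⟫ → P v
  ∈-⟪⟫⁻ {v} v∈ with P? v | trans (sym (Vec.lookup∘tabulate (does ∘ P?) v)) (Vec.[]=⇒lookup v∈)
  ... | yes p | _ = p

length-filter-tabulate : ∀ {A : Set} {P : A → Set} (P? : Unary.Decidable P) (f : Fin n → A) →
  length (filter P? (tabulate f)) ≡ ∣ ⟪ P? ∘ f ⟫ ∣
length-filter-tabulate {zero}  P? f = refl
length-filter-tabulate {suc n} P? f with does (P? (f zero))
... | true  = cong suc (length-filter-tabulate P? (f ∘ suc))
... | false = length-filter-tabulate P? (f ∘ suc)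

length-filter-allFin≡0⁺ : {P : Fin n → Set} (P? : Unary.Decidable P) →
  (∀ i → ¬ P i) → length (filter P? (allFin n)) ≡ 0
length-filter-allFin≡0⁺ {n} P? ¬P = cong length (filter-none P? {xs = allFin n} (All.tabulate (λ {i} _ → ¬P i)))

length-filter-allFin≡0⁻ : {P : Fin n → Set} (P? : Unary.Decidable P) →
  length (filter P? (allFin n)) ≡ 0 → ∀ i → ¬ P i
length-filter-allFin≡0⁻ P? ≡0 i p = ℕ.<⇒≢ (filter-some P? (lose (∈-allFin i) p)) (sym ≡0)

-- Partial colorings

-- Vertices outside `S` carry `nothing`, so vectors keep length n, and the graph and its orientation
-- stay the same while vertices are removed.
partials : Subset n → ∀ N → List (Vec (Maybe (Fin N)) n)
partials []          N = [] ∷ []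
partials (false ∷ S) N = map (nothing ∷_) (partials S N)
partials (true  ∷ S) N = cartesianProductWith (λ i χ → just i ∷ χ) (allFin N) (partials S N)

∑-words-allFin : ∀ n (f : Vec (Fin N) n → ℤ) (f′ : Vec (Maybe (Fin N)) n → ℤ) →
  (∀ χ → f χ ≡ f′ (Vec.map just χ)) →
  ∑ (words (allFin N) n) f ≡ ∑ (partials ⊤ N) f′
∑-words-allFin         zero    f f′ f≡ = cong (_+ 0ℤ) (f≡ [])
∑-words-allFin {N = N} (suc n) f f′ f≡ = begin
  ∑ (words (allFin N) (suc n)) f
    ≡⟨ ∑-cartesianProductWith _∷_ (allFin N) (words (allFin N) n) f ⟩
  ∑ (allFin N) (λ i → ∑ (words (allFin N) n) (f ∘ (i ∷_)))
    ≡⟨ ∑-cong (allFin N) (λ i → ∑-words-allFin n (f ∘ (i ∷_)) (f′ ∘ (just i ∷_)) (f≡ ∘ (i ∷_))) ⟩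
  ∑ (allFin N) (λ i → ∑ (partials ⊤ N) (f′ ∘ (just i ∷_)))
    ≡⟨ ∑-cartesianProductWith (λ i χ → just i ∷ χ) (allFin N) (partials ⊤ N) f′ ⟨
  ∑ (partials ⊤ N) f′ ∎

-- χ⁺ colors S, its first color class is T, and χ is the rest of χ⁺, a coloring of S ─ T.
data Painted {N} : Subset n → Subset n → Vec (Maybe (Fin N)) n → Vec (Maybe (Fin (suc N))) n → Set where
  []    : Painted [] [] [] []
  out   : ∀ {S T : Subset n} {χ χ⁺} → Painted S T χ χ⁺ →
          Painted (false ∷ S) (false ∷ T) (nothing ∷ χ) (nothing ∷ χ⁺)
  now   : ∀ {S T : Subset n} {χ χ⁺} → Painted S T χ χ⁺ →
          Painted (true ∷ S) (true ∷ T) (nothing ∷ χ) (just zero ∷ χ⁺)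
  later : ∀ {S T : Subset n} {χ χ⁺} i → Painted S T χ χ⁺ →
          Painted (true ∷ S) (false ∷ T) (just i ∷ χ) (just (suc i) ∷ χ⁺)

-- A coloring with one more color amounts to its first color class `T` and a coloring of `S ─ T` by
-- the other colors. Comparing summands along `Painted` replaces an explicit bijection.
∑-partials-suc : ∀ (S : Subset n) (f : Vec (Maybe (Fin (suc N))) n → ℤ)
  (g : Subset n → Vec (Maybe (Fin N)) n → ℤ) →
  (∀ {T χ χ⁺} → Painted S T χ χ⁺ → f χ⁺ ≡ g T χ) →
  ∑ (partials S (suc N)) f ≡ ∑ (subsets S) λ T → ∑ (partials (S ─ T) N) (g T)
∑-partials-suc []                  f g f≡ = trans (cong (_+ 0ℤ) (f≡ [])) (sym (ℤ.+-identityʳ _))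
∑-partials-suc {N = N} (false ∷ S) f g f≡ = begin
  ∑ (map (nothing ∷_) (partials S (suc N))) f
    ≡⟨ ∑-map (nothing ∷_) (partials S (suc N)) f ⟩
  ∑ (partials S (suc N)) (f ∘ (nothing ∷_))
    ≡⟨ ∑-partials-suc S (f ∘ (nothing ∷_)) (λ T χ → g (false ∷ T) (nothing ∷ χ)) (f≡ ∘ out) ⟩
  ∑ (subsets S) (λ T → ∑ (partials (S ─ T) N) (g (false ∷ T) ∘ (nothing ∷_)))
    ≡⟨ ∑-cong (subsets S) (λ T → ∑-map (nothing ∷_) (partials (S ─ T) N) (g (false ∷ T))) ⟨
  ∑ (subsets S) (λ T → ∑ (partials ((false ∷ S) ─ (false ∷ T)) N) (g (false ∷ T)))
    ≡⟨ ∑-map (false ∷_) (subsets S) (λ T → ∑ (partials ((false ∷ S) ─ T) N) (g T)) ⟨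
  ∑ (map (false ∷_) (subsets S)) (λ T → ∑ (partials ((false ∷ S) ─ T) N) (g T)) ∎
∑-partials-suc {N = N} (true ∷ S) f g f≡ = begin
  ∑ (partials (true ∷ S) (suc N)) f
    ≡⟨ ∑-cartesianProductWith (λ i χ → just i ∷ χ) (allFin (suc N)) (partials S (suc N)) f ⟩
  ∑ (allFin (suc N)) (λ i → ∑ (partials S (suc N)) (f ∘ (just i ∷_)))
    ≡⟨ ∑-allFin-suc N (λ i → ∑ (partials S (suc N)) (f ∘ (just i ∷_))) ⟩
  ∑ (partials S (suc N)) (f ∘ (just zero ∷_)) +
  ∑ (allFin N) (λ i → ∑ (partials S (suc N)) (f ∘ (just (suc i) ∷_)))
    ≡⟨ cong₂ _+_
         (∑-partials-suc S (f ∘ (just zero ∷_)) (λ T χ → g (true ∷ T) (nothing ∷ χ)) (f≡ ∘ now))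
         (∑-cong (allFin N) (λ i →
           ∑-partials-suc S (f ∘ (just (suc i) ∷_)) (λ T χ → g (false ∷ T) (just i ∷ χ)) (f≡ ∘ later i))) ⟩
  ∑ (subsets S) (λ T → ∑ (partials (S ─ T) N) (g (true ∷ T) ∘ (nothing ∷_))) +
  ∑ (allFin N) (λ i → ∑ (subsets S) (λ T → ∑ (partials (S ─ T) N) (g (false ∷ T) ∘ (just i ∷_))))
    ≡⟨ cong₂ _+_
         (∑-cong (subsets S) (λ T → sym (∑-map (nothing ∷_) (partials (S ─ T) N) (g (true ∷ T)))))
         (trans (∑-swap (allFin N) (subsets S) _)
           (∑-cong (subsets S) (λ T → sym
             (∑-cartesianProductWith (λ i χ → just i ∷ χ) (allFin N) (partials (S ─ T) N) (g (false ∷ T)))))) ⟩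
  ∑ (subsets S) (h ∘ (true ∷_)) + ∑ (subsets S) (h ∘ (false ∷_))
    -- The color `zero` is enumerated first, but `subsets` begins with the sets that avoid the first
    -- vertex.
    ≡⟨ ℤ.+-comm (∑ (subsets S) (h ∘ (true ∷_))) _ ⟩
  ∑ (subsets S) (h ∘ (false ∷_)) + ∑ (subsets S) (h ∘ (true ∷_))
    ≡⟨ cong₂ _+_ (∑-map (false ∷_) (subsets S) h) (∑-map (true ∷_) (subsets S) h) ⟨
  ∑ (map (false ∷_) (subsets S)) h + ∑ (map (true ∷_) (subsets S)) h
    ≡⟨ ∑-++ (map (false ∷_) (subsets S)) (map (true ∷_) (subsets S)) h ⟨
  ∑ (subsets (true ∷ S)) h ∎
  where
  h : Subset _ → ℤ
  h T = ∑ (partials ((true ∷ S) ─ T) N) (g T)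

∑-partials-0 : ∀ (S : Subset n) (f : Vec (Maybe (Fin 0)) n → ℤ) → (∀ χ → f χ ≡ 1ℤ) →
  ∑ (partials S 0) f ≡ ⟦ ∣ S ∣ ≟ 0 ⟧
∑-partials-0 []          f f≡1 = cong (_+ 0ℤ) (f≡1 [])
∑-partials-0 (false ∷ S) f f≡1 =
  trans (∑-map (nothing ∷_) (partials S 0) f) (∑-partials-0 S (f ∘ (nothing ∷_)) (f≡1 ∘ (nothing ∷_)))
∑-partials-0 (true  ∷ S) f f≡1 = refl

partials-just : ∀ (S : Subset n) {χ v} → χ ∈ partials S N → v Subset.∈ S → ∃[ i ] lookup χ v ≡ just i
partials-just {N = N} (true ∷ S) χ∈ v∈ with ∈-cartesianProductWith⁻ (λ i χ → just i ∷ χ) (allFin N) (partials S N) χ∈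
partials-just (true ∷ S) χ∈ Vec.here       | i , _ , _ , _  , refl = i , refl
partials-just (true ∷ S) χ∈ (Vec.there v∈) | _ , _ , _ , χ∈′ , refl = partials-just S χ∈′ v∈
partials-just (false ∷ S) χ∈ (Vec.there v∈) with _ , χ∈′ , refl ← ∈-map⁻ (nothing ∷_) χ∈ = partials-just S χ∈′ v∈

occurrences : Vec (Maybe (Fin N)) n → Fin N → ℕ
occurrences χ i = Vec.count (λ x → Maybe.≡-dec Fin._≟_ x (just i)) χ

content? : Vec (Maybe (Fin N)) n → Vec ℕ N
content? χ = Vec.tabulate (occurrences χ)

content?-Painted : ∀ {S T : Subset n} {χ : Vec (Maybe (Fin N)) n} {χ⁺} → Painted S T χ χ⁺ →
  content? χ⁺ ≡ ∣ T ∣ ∷ content? χ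
content?-Painted p = cong₂ _∷_ (first p) (Vec.tabulate-cong (others p))
  where
  first : ∀ {n} {S T : Subset n} {χ : Vec (Maybe (Fin _)) n} {χ⁺} → Painted S T χ χ⁺ → occurrences χ⁺ zero ≡ ∣ T ∣
  first []          = refl
  first (out p)     = first p
  first (now p)     = cong suc (first p)
  first (later i p) = first p
  others : ∀ {n} {S T : Subset n} {χ : Vec (Maybe (Fin _)) n} {χ⁺} → Painted S T χ χ⁺ →
    ∀ j → occurrences χ⁺ (suc j) ≡ occurrences χ j
  others []          j = refl
  others (out p)     j = others p j
  others (now p)     j = others p j
  others (later i p) j = cong (if does (i Fin.≟ j) then suc else id) (others p j)

content?-just : ∀ (χ : Vec (Fin N) n) → Vec.tabulate (λ i → Vec.count (Fin._≟ i) χ) ≡ content? (Vec.map just χ)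
content?-just χ = Vec.tabulate-cong (go χ)
  where
  go : ∀ {n} (χ : Vec (Fin _) n) i → Vec.count (Fin._≟ i) χ ≡ occurrences (Vec.map just χ) i
  go []      i = refl
  go (x ∷ χ) i = cong (if does (x Fin.≟ i) then suc else id) (go χ i)

-- The content of `Painted` at a single vertex. Membership is abstracted to two types, so that the
-- comparisons of colors become pure case analyses.
data Status {N} (InS InT : Set) : Maybe (Fin N) → Maybe (Fin (suc N)) → Set where
  out   : ¬ InS → ¬ InT → Status InS InT nothing nothing
  now   : InS → InT → Status InS InT nothing (just zero)
  later : ∀ i → InS → ¬ InT → Status InS InT (just i) (just (suc i))

Status-there : ∀ {S T : Subset n} {s t v} {x : Maybe (Fin N)} {x⁺} →
  Status (v Subset.∈ S) (v Subset.∈ T) x x⁺ → Status (suc v Subset.∈ s ∷ S) (suc v Subset.∈ t ∷ T) x x⁺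
Status-there (out ∉S ∉T)     = out (∉S ∘ Subset.drop-there) (∉T ∘ Subset.drop-there)
Status-there (now ∈S ∈T)     = now (Vec.there ∈S) (Vec.there ∈T)
Status-there (later i ∈S ∉T) = later i (Vec.there ∈S) (∉T ∘ Subset.drop-there)

status : ∀ {S T : Subset n} {χ : Vec (Maybe (Fin N)) n} {χ⁺} → Painted S T χ χ⁺ →
  ∀ v → Status (v Subset.∈ S) (v Subset.∈ T) (lookup χ v) (lookup χ⁺ v)
status (out p)     zero    = out (λ ()) (λ ())
status (now p)     zero    = now Vec.here Vec.here
status (later i p) zero    = later i Vec.here (λ ())
status (out p)     (suc v) = Status-there (status p v)
status (now p)     (suc v) = Status-there (status p v)
status (later i p) (suc v) = Status-there (status p v)

-- Two strict orders on colors and their first color class.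

-- Required of the colors of the head and the tail of an arc; nothing marks removed vertices,
-- whose arcs impose no condition.
Below : Maybe (Fin N) → Maybe (Fin N) → Set
Below nothing  y        = Unit
Below (just i) nothing  = Unit
Below (just i) (just j) = i Fin.< j

below? : ∀ (x y : Maybe (Fin N)) → Dec (Below x y)
below? nothing  y        = yes tt
below? (just i) nothing  = yes tt
below? (just i) (just j) = i Fin.<? j

-- The strict order on colors in which the first color is moved to the top.
Beneath : Maybe (Fin N) → Maybe (Fin N) → Set
Beneath nothing        y              = ⊥
Beneath (just zero)    y              = ⊥
Beneath (just (suc i)) nothing        = ⊥
Beneath (just (suc i)) (just zero)    = Unit
Beneath (just (suc i)) (just (suc j)) = i Fin.< j

beneath? : ∀ (x y : Maybe (Fin N)) → Dec (Beneath x y)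
beneath? nothing        y              = no id
beneath? (just zero)    y              = no id
beneath? (just (suc i)) nothing        = no id
beneath? (just (suc i)) (just zero)    = yes tt
beneath? (just (suc i)) (just (suc j)) = i Fin.<? j

-- The order is total: distinct colors direct an edge in exactly one way, and equal colors, as at a
-- loop, in none.
beneath-tournament : ∀ (i j : Fin N) →
  ⟦ ¬? (i Fin.≟ j) ⟧ ≡ ⟦ beneath? (just j) (just i) ⟧ + ⟦ beneath? (just i) (just j) ⟧
beneath-tournament zero    zero    = refl
beneath-tournament zero    (suc j) = refl
beneath-tournament (suc i) zero    = refl
beneath-tournament (suc i) (suc j) with Fin.<-cmp i j
... | tri< i<j i≢j j≮i = trans (⟦⟧-true (¬? (suc i Fin.≟ suc j)) (i≢j ∘ Fin.suc-injective))
  (sym (cong₂ _+_ (⟦⟧-false (j Fin.<? i) j≮i) (⟦⟧-true (i Fin.<? j) i<j)))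
... | tri≈ i≮j i≡j j≮i = trans (⟦⟧-false (¬? (suc i Fin.≟ suc j)) (λ i≢j → i≢j (cong suc i≡j)))
  (sym (cong₂ _+_ (⟦⟧-false (j Fin.<? i) j≮i) (⟦⟧-false (i Fin.<? j) i≮j)))
... | tri> i≮j i≢j j<i = trans (⟦⟧-true (¬? (suc i Fin.≟ suc j)) (i≢j ∘ Fin.suc-injective))
  (sym (cong₂ _+_ (⟦⟧-true (j Fin.<? i) j<i) (⟦⟧-false (i Fin.<? j) i≮j)))

module _ {N : ℕ} {InS InT InS′ InT′ : Set} {x y : Maybe (Fin N)} {x⁺ y⁺ : Maybe (Fin (suc N))} where

  -- Here `x⁺` colors a head and `y⁺` a tail. With the first color on top, an arc into the first
  -- class fails, and an arc from it to the rest holds. This makes the first class a set of sources.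
  beneath-suc⁻ : Status InS InT x x⁺ → Status InS′ InT′ y y⁺ →
    Beneath x⁺ y⁺ → ¬ InT × Below x y
  beneath-suc⁻ (later i _ ∉T) (now _ _)     _   = ∉T , tt
  beneath-suc⁻ (later i _ ∉T) (later j _ _) i<j = ∉T , i<j

  beneath-suc⁺ : Status InS InT x x⁺ → Status InS′ InT′ y y⁺ →
    InS → InS′ → ¬ InT × Below x y → Beneath x⁺ y⁺
  beneath-suc⁺ (out ∉S _)    _             ∈S _   _         = ∉S ∈S
  beneath-suc⁺ (now _ ∈T)    _             _  _   (∉T , _)  = ∉T ∈T
  beneath-suc⁺ (later i _ _) (out ∉S′ _)   _  ∈S′ _         = ∉S′ ∈S′
  beneath-suc⁺ (later i _ _) (now _ _)     _  _   _         = tt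
  beneath-suc⁺ (later i _ _) (later j _ _) _  _   (_ , i<j) = i<j

  -- With the first color at the bottom, an arc out of the first class must have its head outside
  -- `S`. This makes the first class a set of sinks of what remains.
  below-suc⁻ : Status InS InT x x⁺ → Status InS′ InT′ y y⁺ →
    Below x⁺ y⁺ → (InT′ → ¬ InS) × Below x y
  below-suc⁻ (out ∉S _)    _               _   = (λ _ → ∉S) , tt
  below-suc⁻ (now _ _)     (out _ ∉T′)     _   = (λ ∈T′ _ → ∉T′ ∈T′) , tt
  below-suc⁻ (now _ _)     (later _ _ ∉T′) _   = (λ ∈T′ _ → ∉T′ ∈T′) , tt
  below-suc⁻ (later i _ _) (out _ ∉T′)     _   = (λ ∈T′ _ → ∉T′ ∈T′) , tt
  below-suc⁻ (later i _ _) (later j _ ∉T′) i<j = (λ ∈T′ _ → ∉T′ ∈T′) , ℕ.s≤s⁻¹ i<j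

  below-suc⁺ : Status InS InT x x⁺ → Status InS′ InT′ y y⁺ →
    (InT′ → ¬ InS) × Below x y → Below x⁺ y⁺
  below-suc⁺ (out _ _)      _             _            = tt
  below-suc⁺ (now _ _)      (out _ _)     _            = tt
  below-suc⁺ (now ∈S _)     (now _ ∈T′)   (T′⇒∉S , _)  = contradiction ∈S (T′⇒∉S ∈T′)
  below-suc⁺ (now _ _)      (later _ _ _) _            = s≤s z≤n
  below-suc⁺ (later i _ _)  (out _ _)     _            = tt
  below-suc⁺ (later i ∈S _) (now _ ∈T′)   (T′⇒∉S , _)  = contradiction ∈S (T′⇒∉S ∈T′)
  below-suc⁺ (later i _ _)  (later j _ _) (_ , i<j)    = s≤s i<j

-- Independent choices of a direction for every edge.

⟦all?⟧-suc : ∀ {m} {P : Fin (suc m) → Set} (P? : Unary.Decidable P) →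
  ⟦ Fin.all? P? ⟧ ≡ ⟦ P? zero ⟧ * ⟦ Fin.all? (P? ∘ suc) ⟧
⟦all?⟧-suc P? = trans
  (⟦⟧-cong (Fin.all? P?) (P? zero ×-dec Fin.all? (P? ∘ suc))
    (λ p → p zero , p ∘ suc) (λ { (p , _) zero → p ; (_ , p) (suc i) → p i }))
  (⟦⟧-× (P? zero) (Fin.all? (P? ∘ suc)))

bools : List Bool
bools = true ∷ false ∷ []

-- Multiplies out a product of two-term sums, one factor per edge.
⟦all?⟧-choices : ∀ m {P : Fin m → Set} {Q : Fin m → Bool → Set}
  (P? : Unary.Decidable P) (Q? : ∀ i b → Dec (Q i b)) →
  (∀ i → ⟦ P? i ⟧ ≡ ⟦ Q? i true ⟧ + ⟦ Q? i false ⟧) →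
  ⟦ Fin.all? P? ⟧ ≡ ∑ (words bools m) λ ω → ⟦ Fin.all? (λ i → Q? i (lookup ω i)) ⟧
⟦all?⟧-choices zero    P? Q? P≡ = trans (⟦⟧-true (Fin.all? P?) (λ ()))
  (sym (trans (ℤ.+-identityʳ _) (⟦⟧-true (Fin.all? (λ i → Q? i (lookup [] i))) (λ ()))))
⟦all?⟧-choices (suc m) P? Q? P≡ = begin
  ⟦ Fin.all? P? ⟧
    ≡⟨ ⟦all?⟧-suc P? ⟩
  ⟦ P? zero ⟧ * ⟦ Fin.all? (P? ∘ suc) ⟧
    ≡⟨ cong₂ _*_ (P≡ zero) (⟦all?⟧-choices m (P? ∘ suc) (Q? ∘ suc) (P≡ ∘ suc)) ⟩
  (⟦ Q? zero true ⟧ + ⟦ Q? zero false ⟧) * s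
    ≡⟨ expand ⟦ Q? zero true ⟧ ⟦ Q? zero false ⟧ s ⟩
  ∑ bools (λ b → ⟦ Q? zero b ⟧ * s)
    ≡⟨ ∑-cong bools (λ b → trans (sym (∑-*ˡ (words bools m) ⟦ Q? zero b ⟧ _))
         (∑-cong (words bools m) (λ ω → sym (⟦all?⟧-suc (λ i → Q? i (lookup (b ∷ ω) i)))))) ⟩
  ∑ bools (λ b → ∑ (words bools m) λ ω → ⟦ Fin.all? (λ i → Q? i (lookup (b ∷ ω) i)) ⟧)
    ≡⟨ ∑-cartesianProductWith _∷_ bools (words bools m) _ ⟨
  ∑ (words bools (suc m)) (λ ω → ⟦ Fin.all? (λ i → Q? i (lookup ω i)) ⟧) ∎
  where
  s : ℤ
  s = ∑ (words bools m) λ ω → ⟦ Fin.all? (λ i → Q? (suc i) (lookup ω i)) ⟧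
  expand : ∀ x y s → (x + y) * s ≡ x * s + (y * s + 0ℤ)
  expand = solve-∀

xy∙zw≡x[z[yw]] : ∀ x y z w → (x * y) * (z * w) ≡ x * (z * (y * w))
xy∙zw≡x[z[yw]] = solve-∀

content≟ : (χ : Vec (Maybe (Fin N)) n) (α : Vec ℕ N) → Dec (content? χ ≡ α)
content≟ χ α = Vec.≡-dec _≟_ (content? χ) α

⟦content≟⟧-Painted : ∀ {S T : Subset n} {χ : Vec (Maybe (Fin N)) n} {χ⁺} → Painted S T χ χ⁺ → ∀ a α →
  ⟦ content≟ χ⁺ (a ∷ α) ⟧ ≡ ⟦ ∣ T ∣ ≟ a ⟧ * ⟦ content≟ χ α ⟧
⟦content≟⟧-Painted {T = T} {χ} p a α = trans
  (cong (λ β → ⟦ Vec.≡-dec _≟_ β (a ∷ α) ⟧) (content?-Painted p))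
  (⟦⟧-× (∣ T ∣ ≟ a) (content≟ χ α))

-- Colorings compatible with a fixed orientation.

module _ (G : Multigraph n) where

  open Multigraph G

  module _ (ω : Orientation G) where

    Increasing : Vec (Maybe (Fin N)) n → Set
    Increasing χ = ∀ ε → Below (lookup χ (head G ω ε)) (lookup χ (tail G ω ε))

    increasing? : (χ : Vec (Maybe (Fin N)) n) → Dec (Increasing χ)
    increasing? χ = Fin.all? λ ε → below? (lookup χ (head G ω ε)) (lookup χ (tail G ω ε))

    -- For acyclic `ω` this is the generating function of the strict P-partitions of the order that
    -- `ω` induces on `S`, heads lying below tails.
    K : Subset n → Series
    K S {N} α = ∑ (partials S N) λ χ → ⟦ increasing? χ ⟧ * ⟦ content≟ χ α ⟧

    NoArcInto : Subset n → Fin n → Set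
    NoArcInto S v = ∀ ε → tail G ω ε ≡ v → head G ω ε Subset.∉ S

    noArcInto? : ∀ S → Unary.Decidable (NoArcInto S)
    noArcInto? S v = Fin.all? λ ε → (tail G ω ε Fin.≟ v) →-dec ¬? (head G ω ε Subset.∈? S)

    sinks : Subset n → Subset n
    sinks S = S ∩ ⟪ noArcInto? S ⟫

    IsSource IsSink : Fin n → Set
    IsSource v = inDegree G ω v ≡ 0
    IsSink   v = outDegree G ω v ≡ 0

    isSource? : Unary.Decidable IsSource
    isSource? v = inDegree G ω v ≟ 0

    isSink? : Unary.Decidable IsSink
    isSink? v = outDegree G ω v ≟ 0

    sources : Subset n
    sources = ⟪ isSource? ⟫

    ∣sources∣≡ : #sources G ω ≡ ∣ sources ∣
    ∣sources∣≡ = length-filter-tabulate isSource? id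

    IsSource⇒head≢ : ∀ {v} → IsSource v → ∀ ε → head G ω ε ≢ v
    IsSource⇒head≢ {v} = length-filter-allFin≡0⁻ (λ ε → head G ω ε Fin.≟ v)

    head≢⇒IsSource : ∀ {v} → (∀ ε → head G ω ε ≢ v) → IsSource v
    head≢⇒IsSource {v} = length-filter-allFin≡0⁺ (λ ε → head G ω ε Fin.≟ v)

    IsSink⇒tail≢ : ∀ {v} → IsSink v → ∀ ε → tail G ω ε ≢ v
    IsSink⇒tail≢ {v} = length-filter-allFin≡0⁻ (λ ε → tail G ω ε Fin.≟ v)

    tail≢⇒IsSink : ∀ {v} → (∀ ε → tail G ω ε ≢ v) → IsSink v
    tail≢⇒IsSink {v} = length-filter-allFin≡0⁺ (λ ε → tail G ω ε Fin.≟ v)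

    strip : Subset n → List (ℕ × Subset n)
    strip S = map (λ T → ∣ T ∣ , S ─ T) (subsets (sinks S))

    ⟦increasing?⟧-Painted : ∀ {S T} {χ : Vec (Maybe (Fin N)) n} {χ⁺} → Painted S T χ χ⁺ →
      ⟦ increasing? χ⁺ ⟧ ≡ ⟦ T Subset.⊆? ⟪ noArcInto? S ⟫ ⟧ * ⟦ increasing? χ ⟧
    ⟦increasing?⟧-Painted {S = S} {T} {χ} {χ⁺} p = trans
      (⟦⟧-cong (increasing? χ⁺) (T Subset.⊆? ⟪ noArcInto? S ⟫ ×-dec increasing? χ) to from)
      (⟦⟧-× (T Subset.⊆? ⟪ noArcInto? S ⟫) (increasing? χ))
      where
      to : Increasing χ⁺ → T ⊆ ⟪ noArcInto? S ⟫ × Increasing χ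
      to inc = (λ {v} v∈T → ∈-⟪⟫⁺ (noArcInto? S) λ { ε refl → proj₁ (edge ε) v∈T }) , λ ε → proj₂ (edge ε)
        where
        edge = λ ε → below-suc⁻ (status p (head G ω ε)) (status p (tail G ω ε)) (inc ε)
      from : T ⊆ ⟪ noArcInto? S ⟫ × Increasing χ → Increasing χ⁺
      from (T⊆ , inc) ε = below-suc⁺ (status p (head G ω ε)) (status p (tail G ω ε))
        ((λ ∈T → ∈-⟪⟫⁻ (noArcInto? S) (T⊆ ∈T) ε refl) , inc ε)

    -- The first color is the smallest, so its class is an arbitrary, possibly empty, set of sinks
    -- of `S`, and the rest is again an increasing coloring. This is the form that `T-D-strip` asks
    -- of its family.
    K-∷ : ∀ S {N} a (α : Vec ℕ N) →
      K S (a ∷ α) ≡ ∑ (strip S) λ p → ⟦ proj₁ p ≟ a ⟧ * K (proj₂ p) α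
    K-∷ S {N} a α = begin
      K S (a ∷ α)
        ≡⟨ ∑-partials-suc S _ (λ T χ → ⟦ T⊆? T ⟧ * (⟦ ∣ T ∣ ≟ a ⟧ * (⟦ increasing? χ ⟧ * ⟦ content≟ χ α ⟧)))
             (λ {T} {χ} p → trans (cong₂ _*_ (⟦increasing?⟧-Painted p) (⟦content≟⟧-Painted p a α))
               (xy∙zw≡x[z[yw]] ⟦ T⊆? T ⟧ ⟦ increasing? χ ⟧ ⟦ ∣ T ∣ ≟ a ⟧ ⟦ content≟ χ α ⟧)) ⟩
      ∑ (subsets S) (λ T → ∑ (partials (S ─ T) N) λ χ →
        ⟦ T⊆? T ⟧ * (⟦ ∣ T ∣ ≟ a ⟧ * (⟦ increasing? χ ⟧ * ⟦ content≟ χ α ⟧)))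
        ≡⟨ ∑-cong (subsets S) (λ T → trans (∑-*ˡ (partials (S ─ T) N) ⟦ T⊆? T ⟧ _)
             (cong (⟦ T⊆? T ⟧ *_) (∑-*ˡ (partials (S ─ T) N) ⟦ ∣ T ∣ ≟ a ⟧ _))) ⟩
      ∑ (subsets S) (λ T → ⟦ T⊆? T ⟧ * (⟦ ∣ T ∣ ≟ a ⟧ * K (S ─ T) α))
        ≡⟨ ∑-subsets-∩ S ⟪ noArcInto? S ⟫ (λ T → ⟦ ∣ T ∣ ≟ a ⟧ * K (S ─ T) α) ⟩
      ∑ (subsets (sinks S)) (λ T → ⟦ ∣ T ∣ ≟ a ⟧ * K (S ─ T) α)
        ≡⟨ ∑-map (λ T → ∣ T ∣ , S ─ T) (subsets (sinks S)) (λ p → ⟦ proj₁ p ≟ a ⟧ * K (proj₂ p) α) ⟨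
      ∑ (strip S) (λ p → ⟦ proj₁ p ≟ a ⟧ * K (proj₂ p) α) ∎
      where
      T⊆? : ∀ T → Dec (T ⊆ ⟪ noArcInto? S ⟫)
      T⊆? T = T Subset.⊆? ⟪ noArcInto? S ⟫

    TopIncreasing : Vec (Maybe (Fin N)) n → Set
    TopIncreasing χ = ∀ ε → Beneath (lookup χ (head G ω ε)) (lookup χ (tail G ω ε))

    topIncreasing? : (χ : Vec (Maybe (Fin N)) n) → Dec (TopIncreasing χ)
    topIncreasing? χ = Fin.all? λ ε → beneath? (lookup χ (head G ω ε)) (lookup χ (tail G ω ε))

    ⟦topIncreasing?⟧-Painted : ∀ {T} {χ : Vec (Maybe (Fin N)) n} {χ⁺} → Painted ⊤ T χ χ⁺ →
      ⟦ topIncreasing? χ⁺ ⟧ ≡ ⟦ T Subset.⊆? sources ⟧ * ⟦ increasing? χ ⟧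
    ⟦topIncreasing?⟧-Painted {T = T} {χ} {χ⁺} p = trans
      (⟦⟧-cong (topIncreasing? χ⁺) (T Subset.⊆? sources ×-dec increasing? χ) to from)
      (⟦⟧-× (T Subset.⊆? sources) (increasing? χ))
      where
      to : TopIncreasing χ⁺ → T ⊆ sources × Increasing χ
      to ben = (λ {v} v∈T → ∈-⟪⟫⁺ isSource? (head≢⇒IsSource λ { ε refl → proj₁ (edge ε) v∈T })) , λ ε → proj₂ (edge ε)
        where
        edge = λ ε → beneath-suc⁻ (status p (head G ω ε)) (status p (tail G ω ε)) (ben ε)
      from : T ⊆ sources × Increasing χ → TopIncreasing χ⁺
      from (T⊆ , inc) ε = beneath-suc⁺ (status p (head G ω ε)) (status p (tail G ω ε)) Subset.∈⊤ Subset.∈⊤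
        ((λ ∈T → IsSource⇒head≢ (∈-⟪⟫⁻ isSource? (T⊆ ∈T)) ε refl) , inc ε)

    -- Now the first color is the largest, so its class is a set of sources. The other colors keep
    -- their usual order, and `K` takes over.
    ∑-topIncreasing : ∀ {N} a (α : Vec ℕ N) →
      ∑ (partials ⊤ (suc N)) (λ χ → ⟦ topIncreasing? χ ⟧ * ⟦ content≟ χ (a ∷ α) ⟧) ≡
      ∑ (subsets (⊤ ∩ sources)) λ T → ⟦ ∣ T ∣ ≟ a ⟧ * K (⊤ ─ T) α
    ∑-topIncreasing {N} a α = begin
      ∑ (partials ⊤ (suc N)) (λ χ → ⟦ topIncreasing? χ ⟧ * ⟦ content≟ χ (a ∷ α) ⟧)
        ≡⟨ ∑-partials-suc ⊤ _ (λ T χ → ⟦ T⊆? T ⟧ * (⟦ ∣ T ∣ ≟ a ⟧ * (⟦ increasing? χ ⟧ * ⟦ content≟ χ α ⟧)))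
             (λ {T} {χ} p → trans (cong₂ _*_ (⟦topIncreasing?⟧-Painted p) (⟦content≟⟧-Painted p a α))
               (xy∙zw≡x[z[yw]] ⟦ T⊆? T ⟧ ⟦ increasing? χ ⟧ ⟦ ∣ T ∣ ≟ a ⟧ ⟦ content≟ χ α ⟧)) ⟩
      ∑ (subsets ⊤) (λ T → ∑ (partials (⊤ ─ T) N) λ χ →
        ⟦ T⊆? T ⟧ * (⟦ ∣ T ∣ ≟ a ⟧ * (⟦ increasing? χ ⟧ * ⟦ content≟ χ α ⟧)))
        ≡⟨ ∑-cong (subsets ⊤) (λ T → trans (∑-*ˡ (partials (⊤ ─ T) N) ⟦ T⊆? T ⟧ _)
             (cong (⟦ T⊆? T ⟧ *_) (∑-*ˡ (partials (⊤ ─ T) N) ⟦ ∣ T ∣ ≟ a ⟧ _))) ⟩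
      ∑ (subsets ⊤) (λ T → ⟦ T⊆? T ⟧ * (⟦ ∣ T ∣ ≟ a ⟧ * K (⊤ ─ T) α))
        ≡⟨ ∑-subsets-∩ ⊤ sources (λ T → ⟦ ∣ T ∣ ≟ a ⟧ * K (⊤ ─ T) α) ⟩
      ∑ (subsets (⊤ ∩ sources)) (λ T → ⟦ ∣ T ∣ ≟ a ⟧ * K (⊤ ─ T) α) ∎
      where
      T⊆? : ∀ T → Dec (T ⊆ sources)
      T⊆? T = T Subset.⊆? sources

    ∑-strip : ∀ S g → ∑ (strip S) (g ∘ proj₁) ≡ ∑-choose ∣ sinks S ∣ g
    ∑-strip S g = trans (∑-map _ (subsets (sinks S)) (g ∘ proj₁)) (∑-subsets-card (sinks S) g)

    strip-size : ∀ S {p} → p ∈ strip S → proj₁ p ℕ.+ ∣ proj₂ p ∣ ≡ ∣ S ∣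
    strip-size S p∈ with T , T∈ , refl ← ∈-map⁻ _ p∈ =
      ∣p∣+∣q─p∣≡∣q∣ T S (Subset.p∩q⊆p S _ ∘ subsets⇒⊆ (sinks S) T∈)

    K-[] : ∀ S → K S [] ≡ ⟦ ∣ S ∣ ≟ 0 ⟧
    K-[] S = ∑-partials-0 S _ (λ χ → trans (ℤ.*-identityʳ _) (⟦⟧-true (increasing? χ) (λ ε → below-0 (lookup χ (head G ω ε)))))
      where
      below-0 : ∀ (x : Maybe (Fin 0)) {y} → Below x y
      below-0 nothing = tt

    -- Consequences of acyclicity.

    module _ (acyclic : Acyclic G ω) where

      ⁺-isStrictPartialOrder : IsStrictPartialOrder _≡_ (TransClosure (Arc G ω))
      ⁺-isStrictPartialOrder = record
        { isEquivalence = isEquivalence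
        ; irrefl        = λ { refl → acyclic _ }
        ; trans         = _++⁺_
        ; <-resp-≈      = (λ { refl r → r }) , (λ { refl r → r })
        }

      -- A walk along arcs inside `S` must stop, since reachability is a strict partial order on a
      -- finite set.
      sink-exists : ∀ {S v} → v Subset.∈ S → ∃[ w ] w Subset.∈ sinks S
      sink-exists {S} {v} v∈S = go v v∈S (spo-noetherian ⁺-isStrictPartialOrder v)
        where
        go : ∀ v → v Subset.∈ S → Acc (λ x y → TransClosure (Arc G ω) y x) v → ∃[ w ] w Subset.∈ sinks S
        go v v∈S (acc rs) with Fin.any? (λ ε → (tail G ω ε Fin.≟ v) ×-dec (head G ω ε Subset.∈? S))
        ... | yes (ε , tail≡v , head∈S) = go (head G ω ε) head∈S (rs [ ε , tail≡v , refl ])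
        ... | no ¬arc = v , Subset.x∈p∩q⁺
          (v∈S , ∈-⟪⟫⁺ (noArcInto? S) (λ ε tail≡v head∈S → ¬arc (ε , tail≡v , head∈S)))

      source-exists : Fin n → ∃[ w ] w Subset.∈ sources
      source-exists v = go v (spo-wellFounded ⁺-isStrictPartialOrder v)
        where
        go : ∀ v → Acc (TransClosure (Arc G ω)) v → ∃[ w ] w Subset.∈ sources
        go v (acc rs) with Fin.any? (λ ε → head G ω ε Fin.≟ v)
        ... | yes (ε , head≡v) = go (tail G ω ε) (rs [ ε , refl , head≡v ])
        ... | no ¬arc = v , ∈-⟪⟫⁺ isSource? (head≢⇒IsSource (λ ε head≡v → ¬arc (ε , head≡v)))

      -- Every nonempty `S` has a sink, so the constant term can be read off from the number of
      -- sinks, which is the width used for `T-D-strip`.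
      K-[]-sinks : ∀ S → K S [] ≡ ⟦ ∣ sinks S ∣ ≟ 0 ⟧
      K-[]-sinks S = trans (K-[] S) (⟦⟧-cong (∣ S ∣ ≟ 0) (∣ sinks S ∣ ≟ 0)
        (λ ∣S∣≡0 → ℕ.n≤0⇒n≡0 (ℕ.≤-trans (Subset.∣p∩q∣≤∣p∣ S _) (ℕ.≤-reflexive ∣S∣≡0)))
        (λ ∣sinks∣≡0 → ∣Empty∣≡0 S λ (v , v∈S) → ∈⇒∣p∣≢0 (proj₂ (sink-exists v∈S)) ∣sinks∣≡0))

      T-D-K : ∀ S → T n n (D n aμ (K S)) ≡ ⟦ ∣ sinks S ∣ ≟ 1 ⟧
      T-D-K S = trans
        (T-D-strip n K strip (∣_∣ ∘ sinks) ∣_∣ K-[]-sinks K-∷ ∑-strip strip-size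
          n aμ S refl (Subset.∣p∣≤n S) (Subset.∣p∣≤n S))
        (∑-choose-aμ ∣ sinks S ∣)

      #sources≢0 : Fin n → #sources G ω ≢ 0
      #sources≢0 v rewrite ∣sources∣≡ = ∈⇒∣p∣≢0 (proj₂ (source-exists v))

    -- Colors drop strictly along directed walks. Every vertex of a cycle is a head, hence lies in
    -- `R` and is colored, so no arc of the cycle escapes the condition.
    Increasing⇒Acyclic : ∀ {R} {χ : Vec (Maybe (Fin N)) n} → (∀ ε → head G ω ε Subset.∈ R) →
      χ ∈ partials R N → Increasing χ → Acyclic G ω
    Increasing⇒Acyclic {N} {R} {χ} head∈R χ∈ inc v cycle =
      let i , χv≡i       = end-just cycle
          j , χv≡j , j<i = decreasing cycle χv≡i
      in ℕ.<⇒≢ j<i (cong Fin.toℕ (Maybe.just-injective (trans (sym χv≡j) χv≡i)))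
      where
      end-just : ∀ {u w} → TransClosure (Arc G ω) u w → ∃[ i ] lookup χ w ≡ just i
      end-just [ ε , _ , refl ] = partials-just R χ∈ (head∈R ε)
      end-just (_ ∷ path)       = end-just path
      arc-decreasing : ∀ {u w i} → Arc G ω u w → lookup χ u ≡ just i →
        ∃[ j ] lookup χ w ≡ just j × j Fin.< i
      arc-decreasing (ε , refl , refl) χu≡ with partials-just R χ∈ (head∈R ε)
      ... | j , χw≡ = j , χw≡ , subst₂ Below χw≡ χu≡ (inc ε)
      decreasing : ∀ {u w i} → TransClosure (Arc G ω) u w → lookup χ u ≡ just i →
        ∃[ j ] lookup χ w ≡ just j × j Fin.< i
      decreasing [ arc ]      χu≡ = arc-decreasing arc χu≡
      decreasing (arc ∷ path) χu≡ =
        let j , χw≡ , j<i = arc-decreasing arc χu≡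
            k , χz≡ , k<j = decreasing path χw≡
        in k , χz≡ , Fin.<-trans k<j j<i

    K-cyclic : ¬ Acyclic G ω → ∀ {R} → (∀ ε → head G ω ε Subset.∈ R) → ∀ {N} (α : Vec ℕ N) → K R α ≡ 0ℤ
    K-cyclic cyclic {R} head∈R {N} α = ∑-zero (partials R N) λ {χ} χ∈ →
      cong (_* ⟦ content≟ χ α ⟧)
        (⟦⟧-false (increasing? χ) (cyclic ∘ Increasing⇒Acyclic head∈R χ∈))

    module _ (noIsolated : ∀ v → ¬ Isolated G v) where

      -- A vertex that is both has no incident edge. The hypothesis on isolated vertices enters the
      -- proof here.
      IsSource⇒¬IsSink : ∀ {v} → IsSource v → ¬ IsSink v
      IsSource⇒¬IsSink {v} source sink = noIsolated v not-incident
        where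
        not-incident : ∀ ε → ¬ Incident G v ε
        not-incident ε inc with lookup ω ε | IsSource⇒head≢ source ε | IsSink⇒tail≢ sink ε
        not-incident ε (inj₁ v≡) | true  | _      | tail≢v = tail≢v v≡
        not-incident ε (inj₁ v≡) | false | head≢v | _      = head≢v v≡
        not-incident ε (inj₂ v≡) | true  | head≢v | _      = head≢v v≡
        not-incident ε (inj₂ v≡) | false | _      | tail≢v = tail≢v v≡

      module _ {S : Subset n} (S⊆sources : S ⊆ sources) where

        head∈⊤─S : ∀ ε → head G ω ε Subset.∈ ⊤ ─ S
        head∈⊤─S ε = Subset.x∈p∧x∉q⇒x∈p─q Subset.∈⊤ λ ∈S →
          IsSource⇒head≢ (∈-⟪⟫⁻ isSource? (S⊆sources ∈S)) ε refl

        -- Deleting sources deletes no head, so every arc still blocks its tail and no new sink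
        -- arises; no old sink is lost, since a source is not a sink.
        sinks-⊤─S : sinks (⊤ ─ S) ≡ ⟪ isSink? ⟫
        sinks-⊤─S = Subset.⊆-antisym to from
          where
          to : sinks (⊤ ─ S) ⊆ ⟪ isSink? ⟫
          to v∈ = ∈-⟪⟫⁺ isSink? (tail≢⇒IsSink λ ε tail≡v →
            ∈-⟪⟫⁻ (noArcInto? (⊤ ─ S)) (proj₂ (Subset.x∈p∩q⁻ (⊤ ─ S) _ v∈)) ε tail≡v (head∈⊤─S ε))
          from : ⟪ isSink? ⟫ ⊆ sinks (⊤ ─ S)
          from v∈ = Subset.x∈p∩q⁺
            ( Subset.x∈p∧x∉q⇒x∈p─q Subset.∈⊤ (λ v∈S → IsSource⇒¬IsSink (∈-⟪⟫⁻ isSource? (S⊆sources v∈S)) sink)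
            , ∈-⟪⟫⁺ (noArcInto? (⊤ ─ S)) (λ ε tail≡v _ → IsSink⇒tail≢ sink ε tail≡v))
            where
            sink = ∈-⟪⟫⁻ isSink? v∈

        T-D-K-⊤─S : T n n (D n aμ (K (⊤ ─ S))) ≡ ⟦ acyclic? G ω ×-dec (#sinks G ω ≟ 1) ⟧
        T-D-K-⊤─S = trans (by-cases (acyclic? G ω)) (sym (⟦⟧-× (acyclic? G ω) (#sinks G ω ≟ 1)))
          where
          by-cases : (d : Dec (Acyclic G ω)) → T n n (D n aμ (K (⊤ ─ S))) ≡ ⟦ d ⟧ * ⟦ #sinks G ω ≟ 1 ⟧
          by-cases (yes acyclic) = begin
            T n n (D n aμ (K (⊤ ─ S)))      ≡⟨ T-D-K acyclic (⊤ ─ S) ⟩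
            ⟦ ∣ sinks (⊤ ─ S) ∣ ≟ 1 ⟧       ≡⟨ cong (λ k → ⟦ k ≟ 1 ⟧) (trans (cong ∣_∣ sinks-⊤─S) (sym (length-filter-tabulate isSink? id))) ⟩
            ⟦ #sinks G ω ≟ 1 ⟧               ≡⟨ ℤ.*-identityˡ ⟦ #sinks G ω ≟ 1 ⟧ ⟨
            1ℤ * ⟦ #sinks G ω ≟ 1 ⟧          ∎
          by-cases (no cyclic) = trans
            (T-cong n n {D n aμ (K (⊤ ─ S))} {D n aμ zero-series}
              (D-cong n aμ {K (⊤ ─ S)} {zero-series} (K-cyclic cyclic head∈⊤─S)))
            -- The zero series is an empty sum, so linearity gives the value 0.
            (T-D-∑ n aμ [] (λ (_ : ℕ) → 0ℤ) (λ _ → zero-series) n)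
            where
            zero-series : Series
            zero-series _ = 0ℤ

      ∑-sources : Fin n → ∀ r →
        ∑ (subsets (⊤ ∩ sources)) (λ S → σ r ∣ S ∣ * T n n (D n aμ (K (⊤ ─ S)))) ≡
        ⟦ acyclic? G ω ×-dec (#sinks G ω ≟ 1) ⟧ * + ((#sources G ω ∸ 1) C r)
      ∑-sources v r = begin
        ∑ (subsets (⊤ ∩ sources)) (λ S → σ r ∣ S ∣ * T n n (D n aμ (K (⊤ ─ S))))
          ≡⟨ ∑-cong-∈ (subsets (⊤ ∩ sources)) (λ {S} S∈ → cong (σ r ∣ S ∣ *_)
               (T-D-K-⊤─S (Subset.p∩q⊆q ⊤ sources ∘ subsets⇒⊆ (⊤ ∩ sources) S∈))) ⟩
        ∑ (subsets (⊤ ∩ sources)) (λ S → σ r ∣ S ∣ * ⟦ Z? ⟧)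
          ≡⟨ ∑-*ʳ (subsets (⊤ ∩ sources)) ⟦ Z? ⟧ (σ r ∘ ∣_∣) ⟩
        ∑ (subsets (⊤ ∩ sources)) (σ r ∘ ∣_∣) * ⟦ Z? ⟧
          ≡⟨ cong (_* ⟦ Z? ⟧) (∑-subsets-card (⊤ ∩ sources) (σ r)) ⟩
        ∑-choose (∣ ⊤ ∩ sources ∣) (σ r) * ⟦ Z? ⟧
          ≡⟨ ℤ.*-comm (∑-choose (∣ ⊤ ∩ sources ∣) (σ r)) ⟦ Z? ⟧ ⟩
        ⟦ Z? ⟧ * ∑-choose (∣ ⊤ ∩ sources ∣) (σ r)
          -- The binomial identity requires at least one source. Acyclicity provides it, so the
          -- identity is proved only under the indicator.
          ≡⟨ ⟦⟧*-cong Z? (λ (acyclic , _) → choose acyclic) ⟩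
        ⟦ Z? ⟧ * + ((#sources G ω ∸ 1) C r) ∎
        where
        Z? : Dec (Acyclic G ω × #sinks G ω ≡ 1)
        Z? = acyclic? G ω ×-dec (#sinks G ω ≟ 1)
        choose : Acyclic G ω → ∑-choose (∣ ⊤ ∩ sources ∣) (σ r) ≡ + ((#sources G ω ∸ 1) C r)
        choose acyclic
          rewrite Subset.∩-identityˡ sources | sym ∣sources∣≡
          with #sources G ω | #sources≢0 acyclic v
        ... | zero  | ≢0 = contradiction refl ≢0
        ... | suc s | _  = ∑-choose-σ r s

      -- Otherwise every vertex would be a source, including a sink, which exists by acyclicity.
      -- This makes the binomials vanish when m = 1.
      #sources<n : Fin n → Acyclic G ω → #sources G ω < n
      #sources<n v acyclic rewrite ∣sources∣≡ =
        ℕ.≤∧≢⇒< (Subset.∣p∣≤n sources) λ ∣sources∣≡n →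
          let w , w∈ = sink-exists acyclic (Subset.∈⊤ {x = v})
              isSource = ∈-⟪⟫⁻ isSource? (subst (w Subset.∈_) (sym (Subset.∣p∣≡n⇒p≡⊤ ∣sources∣≡n)) Subset.∈⊤)
          in IsSource⇒¬IsSink isSource (tail≢⇒IsSink λ ε tail≡w →
               ∈-⟪⟫⁻ (noArcInto? ⊤) (proj₂ (Subset.x∈p∩q⁻ ⊤ _ w∈)) ε tail≡w Subset.∈⊤)

  -- The hook coefficients of the chromatic symmetric function.

  X-∷ : ∀ {N} a (α : Vec ℕ N) → X G (a ∷ α) ≡
    ∑ (orientations G) λ ω → ∑ (subsets (⊤ ∩ sources ω)) λ S → ⟦ ∣ S ∣ ≟ a ⟧ * K ω (⊤ ─ S) α
  X-∷ {N} a α = begin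
    X G (a ∷ α)
      ≡⟨ ∑-length-filter (λ χ → proper? G χ ×-dec content-is χ) colorings ⟩
    ∑ colorings (λ χ → ⟦ proper? G χ ×-dec content-is χ ⟧)
      ≡⟨ ∑-cong colorings (λ χ → trans (⟦⟧-× (proper? G χ) (content-is χ))
           (cong₂ _*_ (orient χ) (cong (λ β → ⟦ Vec.≡-dec _≟_ β (a ∷ α) ⟧) (content?-just χ)))) ⟩
    ∑ colorings (λ χ → ∑ (orientations G) (λ ω → ⟦ topIncreasing? ω (Vec.map just χ) ⟧) * ⟦ content≟ (Vec.map just χ) (a ∷ α) ⟧)
      ≡⟨ ∑-cong colorings (λ χ → ∑-*ʳ (orientations G) ⟦ content≟ (Vec.map just χ) (a ∷ α) ⟧ _) ⟨
    ∑ colorings (λ χ → ∑ (orientations G) (λ ω → body ω (Vec.map just χ)))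
      ≡⟨ ∑-swap colorings (orientations G) (λ χ ω → body ω (Vec.map just χ)) ⟩
    ∑ (orientations G) (λ ω → ∑ colorings (body ω ∘ Vec.map just))
      ≡⟨ ∑-cong (orientations G) (λ ω → trans
           (∑-words-allFin n (body ω ∘ Vec.map just) (body ω) (λ _ → refl)) (∑-topIncreasing ω a α)) ⟩
    ∑ (orientations G) (λ ω → ∑ (subsets (⊤ ∩ sources ω)) λ S → ⟦ ∣ S ∣ ≟ a ⟧ * K ω (⊤ ─ S) α) ∎
    where
    colorings : List (Vec (Fin (suc N)) n)
    colorings = words (allFin (suc N)) n
    content-is : ∀ χ → Dec (content G χ ≡ a ∷ α)
    content-is χ = Vec.≡-dec _≟_ (content G χ) (a ∷ α)
    body : Orientation G → Vec (Maybe (Fin (suc N))) n → ℤ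
    body ω χ = ⟦ topIncreasing? ω χ ⟧ * ⟦ content≟ χ (a ∷ α) ⟧
    orient : ∀ χ → ⟦ proper? G χ ⟧ ≡ ∑ (orientations G) (λ ω → ⟦ topIncreasing? ω (Vec.map just χ) ⟧)
    orient χ = trans
      (⟦all?⟧-choices #edges
        (λ ε → ¬? (lookup χ (proj₁ (ends ε)) Fin.≟ lookup χ (proj₂ (ends ε))))
        choice?
        (λ ε → beneath-tournament (lookup χ (proj₁ (ends ε))) (lookup χ (proj₂ (ends ε)))))
      (∑-cong (orientations G) λ ω → ⟦⟧-cong
        (Fin.all? λ ε → choice? ε (lookup ω ε)) (topIncreasing? ω (Vec.map just χ))
        (λ p ε → subst₂ Beneath (sym (Vec.lookup-map (head G ω ε) just χ)) (sym (Vec.lookup-map (tail G ω ε) just χ)) (to ω ε (p ε)))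
        (λ p ε → from ω ε (subst₂ Beneath (Vec.lookup-map (head G ω ε) just χ) (Vec.lookup-map (tail G ω ε) just χ) (p ε))))
      where
      Choice : Fin #edges → Bool → Set
      Choice ε true  = Beneath (just (lookup χ (proj₂ (ends ε)))) (just (lookup χ (proj₁ (ends ε))))
      Choice ε false = Beneath (just (lookup χ (proj₁ (ends ε)))) (just (lookup χ (proj₂ (ends ε))))
      choice? : ∀ ε b → Dec (Choice ε b)
      choice? ε true  = beneath? _ _
      choice? ε false = beneath? _ _
      to : ∀ ω ε → Choice ε (lookup ω ε) → Beneath (just (lookup χ (head G ω ε))) (just (lookup χ (tail G ω ε)))
      to ω ε p with lookup ω ε
      ... | true  = p
      ... | false = p
      from : ∀ ω ε → Beneath (just (lookup χ (head G ω ε))) (just (lookup χ (tail G ω ε))) → Choice ε (lookup ω ε)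
      from ω ε p with lookup ω ε
      ... | true  = p
      ... | false = p

  hookFunctional-X : (∀ v → ¬ Isolated G v) → Fin n → ∀ r →
    hookFunctional n r (X G) ≡ ∑ (Z G) λ ω → + ((#sources G ω ∸ 1) C r)
  hookFunctional-X noIsolated v r = begin
    T n n (D n aμ (D n (σ r) (X G)))
      ≡⟨ T-cong n n {D n aμ (D n (σ r) (X G))} {D n aμ f} (D-cong n aμ {D n (σ r) (X G)} {f} (λ α →
           D-graded n (σ r) {X G} α pairs (∣_∣ ∘ proj₂) (λ p → K (proj₁ p) (⊤ ─ proj₂ p) α)
             (λ {p} _ → Subset.∣p∣≤n (proj₂ p)) (λ a → trans (X-∷ a α) (sym (∑-pairs _))))) ⟩
    T n n (D n aμ f)
      ≡⟨ T-D-∑ n aμ pairs (λ p → σ r ∣ proj₂ p ∣) (λ p → K (proj₁ p) (⊤ ─ proj₂ p)) n ⟩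
    ∑ pairs (λ p → σ r ∣ proj₂ p ∣ * T n n (D n aμ (K (proj₁ p) (⊤ ─ proj₂ p))))
      ≡⟨ ∑-pairs _ ⟩
    ∑ (orientations G) (λ ω → ∑ (subsets (⊤ ∩ sources ω)) λ S → σ r ∣ S ∣ * T n n (D n aμ (K ω (⊤ ─ S))))
      ≡⟨ ∑-cong (orientations G) (λ ω → ∑-sources ω noIsolated v r) ⟩
    ∑ (orientations G) (λ ω → ⟦ acyclic? G ω ×-dec (#sinks G ω ≟ 1) ⟧ * + ((#sources G ω ∸ 1) C r))
      ≡⟨ ∑-filter (λ ω → acyclic? G ω ×-dec (#sinks G ω ≟ 1)) (orientations G) (λ ω → + ((#sources G ω ∸ 1) C r)) ⟨
    ∑ (Z G) (λ ω → + ((#sources G ω ∸ 1) C r)) ∎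
    where
    -- `D-graded` and `T-D-∑` work with a single list, so the double sum is flattened.
    pairs : List (Orientation G × Subset n)
    pairs = concatMap (λ ω → map (ω ,_) (subsets (⊤ ∩ sources ω))) (orientations G)
    ∑-pairs : ∀ h → ∑ pairs h ≡ ∑ (orientations G) λ ω → ∑ (subsets (⊤ ∩ sources ω)) λ S → h (ω , S)
    ∑-pairs h = trans (∑-concatMap (λ ω → map (ω ,_) (subsets (⊤ ∩ sources ω))) (orientations G) h)
      (∑-cong (orientations G) (λ ω → ∑-map (ω ,_) (subsets (⊤ ∩ sources ω)) h))
    f : Series
    f α = ∑ pairs λ p → σ r ∣ proj₂ p ∣ * K (proj₁ p) (⊤ ─ proj₂ p) α

corollary2p8 : (n m : ℕ) → 1 ≤ m → m ≤ n → (G : Multigraph n) →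
    ((v : Fin n) → ¬ Isolated G v) →
    (c : List ℕ → ℤ) → IsEExpansion n (X G) c →
    c (m ∷ replicate (n ∸ m) 1) ≡ ∑ (Z G) (λ ω → + ((#sources G ω ∸ 1) C (n ∸ m)))
corollary2p8 n m 1≤m m≤n G noIsolated c X≈ =
  -- The degree has to be of the form m + r. Only the number of vertices is transported; `n ∸ m`
  -- stays fixed.
  subst Claim m+r≡n (λ G noIsolated X≈ → claim m (n ∸ m) 1≤m G noIsolated X≈) G noIsolated X≈
  where
  m+r≡n : m ℕ.+ (n ∸ m) ≡ n
  m+r≡n = ℕ.m+[n∸m]≡n m≤n
  Claim : ℕ → Set
  Claim k = (G : Multigraph k) → (∀ v → ¬ Isolated G v) → IsEExpansion k (X G) c →
    c (hook m (n ∸ m)) ≡ ∑ (Z G) (λ ω → + ((#sources G ω ∸ 1) C (n ∸ m)))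
  claim : ∀ m r → 1 ≤ m → (G : Multigraph (m ℕ.+ r)) → (∀ v → ¬ Isolated G v) →
    IsEExpansion (m ℕ.+ r) (X G) c →
    c (hook m r) ≡ ∑ (Z G) (λ ω → + ((#sources G ω ∸ 1) C r))
  -- For m at least 2 the weight is 1, so the functional is the coefficient itself.
  claim (suc (suc m)) r 1≤m G noIsolated X≈ = begin
    c (hook (2 ℕ.+ m) r)
      ≡⟨ ℤ.*-identityˡ _ ⟨
    1ℤ * c (hook (2 ℕ.+ m) r)
      ≡⟨ hookFunctional-expansion (2 ℕ.+ m) r 1≤m (X G) c X≈ ⟨
    hookFunctional (2 ℕ.+ m ℕ.+ r) r (X G)
      ≡⟨ hookFunctional-X G noIsolated zero r ⟩
    ∑ (Z G) (λ ω → + ((#sources G ω ∸ 1) C r)) ∎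
  -- For m = 1 the functional returns n times the coefficient, with n = r + 1. As the sum over `Z G`
  -- is 0, cancelling n shows that the coefficient is 0 too.
  claim (suc zero) r 1≤m G noIsolated X≈ = trans c≡0 (sym RHS≡0)
    where
    RHS≡0 : ∑ (Z G) (λ ω → + ((#sources G ω ∸ 1) C r)) ≡ 0ℤ
    RHS≡0 = ∑-zero (Z G) λ {ω} ω∈ → cong +_ (k>n⇒nCk≡0 (few-sources ω (proj₁ (proj₂
      (∈-filter⁻ (λ ω → acyclic? G ω ×-dec (#sinks G ω ≟ 1)) {xs = orientations G} ω∈)))))
      where
      -- Fewer than n = r + 1 sources and at least one: hence s - 1 < r, and the binomial is 0.
      few-sources : ∀ ω → Acyclic G ω → #sources G ω ∸ 1 < r
      few-sources ω acyclic
        with #sources G ω | #sources<n G ω noIsolated zero acyclic | #sources≢0 G ω acyclic zero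
      ... | zero  | _         | ≢0 = contradiction refl ≢0
      ... | suc _ | s≤s s<r   | _  = s<r
    c≡0 : c (hook 1 r) ≡ 0ℤ
    c≡0 = ℤ.*-cancelˡ-≡ (+ suc r) (c (hook 1 r)) 0ℤ (begin
      + suc r * c (hook 1 r)
        ≡⟨ hookFunctional-expansion 1 r 1≤m (X G) c X≈ ⟨
      hookFunctional (suc r) r (X G)
        ≡⟨ hookFunctional-X G noIsolated zero r ⟩
      ∑ (Z G) (λ ω → + ((#sources G ω ∸ 1) C r))
        ≡⟨ RHS≡0 ⟩
      0ℤ
        ≡⟨ ℤ.*-zeroʳ (+ suc r) ⟨
      + suc r * 0ℤ ∎)
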